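{- Let $m\ge2$ and let $\lambda_m$ be an $m$-core. Then \[ \sum_{\mu\in \mathcal{P}_{\lambda_m}\cap \mathcal{R}_m}q^{|\mu|}=\frac{q^{|\lambda_m|}}{\prod_{i\geq 1}(1-q^{mi})^{m-1}} \qquad\text{and}\qquad \sum_{\mu\in\mathcal{P}_{\lambda_m}}t^{h_{m,0}(\mu)}q^{|\mu|}=\frac{q^{|\lambda_m|}}{\prod_{i\geq 1}(1-q^{mi})^{m-1}(1-tq^{mi})}. \]
   Context: An $m$-core is a partition with no hook length equal to $m$. The $m$-core of a partition $\mu$ is obtained by repeatedly removing rim hooks of length $m$ (leaving a Young diagram each time) until impossible; it is well defined. $\mathcal{P}_{\lambda_m}$ is the set of partitions whose $m$-core is $\lambda_m$. $\mathcal{R}_m$ is the set of $m$-restricted partitions, i.e. partitions $\mu$ with $\mu_i-\mu_{i+1}<m$ for all $i\ge1$ (equivalently, no part of the conjugate partition occurs $m$ or more times). For a cell $v$, $a_v$ is its arm length and $l_v$ its leg length; $h_{m,0}(\mu)$ is the number of cells $v$ of $\mu$ with $l_v=0$ and $m\mid a_v+1$. -}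

module Defs where

open import Data.Nat using (ℕ; zero; suc; _+_; _*_; _∸_; _≤_; _<_; _≥_)
open import Data.Nat.Properties using (_≟_; _<?_)
open import Data.Nat.Divisibility using (_∣_; _∣?_)
open import Data.List using (List; []; _∷_; length; filter; upTo; concatMap; map)
open import Data.Nat.ListAction using (sum)
open import Data.List.Relation.Unary.All using (All)
open import Data.List.Relation.Unary.Linked using (Linked)
open import Data.Product using (_×_; _,_; Σ; ∃)
open import Relation.Nullary using (Dec; yes; no; ¬_)
open import Relation.Nullary.Decidable using (_×-dec_)
open import Relation.Binary.PropositionalEquality using (_≡_; _≢_)
open import Relation.Binary.Construct.Closure.ReflexiveTransitive using (Star)

IsPartition : List ℕ → Set
IsPartition μ = All (0 <_) μ × Linked _≥_ μ

size : List ℕ → ℕ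
size = sum

-- part μ r = μ_{r+1} (0-indexed rows), 0 beyond the length.
part : List ℕ → ℕ → ℕ
part []       _       = 0
part (x ∷ _)  zero    = x
part (_ ∷ xs) (suc r) = part xs r

conjPart : List ℕ → ℕ → ℕ
conjPart μ c = length (filter (c <?_) μ)

-- Cell (r , c) (0-indexed) belongs to μ iff c < μ_{r+1}.
-- arm and leg lengths of such a cell:
arm : List ℕ → ℕ → ℕ → ℕ
arm μ r c = part μ r ∸ suc c

leg : List ℕ → ℕ → ℕ → ℕ
leg μ r c = conjPart μ c ∸ suc r

hook : List ℕ → ℕ → ℕ → ℕ
hook μ r c = arm μ r c + leg μ r c + 1

IsCore : ℕ → List ℕ → Set
IsCore m μ = ∀ r c → c < part μ r → hook μ r c ≢ m

Restricted : ℕ → List ℕ → Set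
Restricted m μ = ∀ i → part μ i ∸ part μ (suc i) < m

Cell : Set
Cell = ℕ × ℕ

InSkew : List ℕ → List ℕ → Cell → Set
InSkew μ ν (r , c) = (c < part μ r) × (part ν r ≤ c)

data Adj : Cell → Cell → Set where
  right : ∀ {r c} → Adj (r , c) (r , suc c)
  left  : ∀ {r c} → Adj (r , suc c) (r , c)
  down  : ∀ {r c} → Adj (r , c) (suc r , c)
  up    : ∀ {r c} → Adj (suc r , c) (r , c)

data Path (S : Cell → Set) : Cell → Cell → Set where
  here : ∀ {p} → S p → Path S p p
  step : ∀ {p q s} → S p → Adj p q → Path S q s → Path S p s

RemoveRimHook : ℕ → List ℕ → List ℕ → Set
RemoveRimHook m μ ν =
  IsPartition ν
  × (∀ r → part ν r ≤ part μ r)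
  × (size μ ≡ size ν + m)
  × (∀ p q → InSkew μ ν p → InSkew μ ν q → Path (InSkew μ ν) p q)
  × (∀ r c → ¬ (InSkew μ ν (r , c) × InSkew μ ν (r , suc c)
                × InSkew μ ν (suc r , c) × InSkew μ ν (suc r , suc c)))

CoreOf : ℕ → List ℕ → List ℕ → Set
CoreOf m μ λc = Star (RemoveRimHook m) μ λc × IsCore m λc

cells : List ℕ → List Cell
cells μ = concatMap (λ r → map (λ c → (r , c)) (upTo (part μ r))) (upTo (length μ))

hm0 : ℕ → List ℕ → ℕ
hm0 m μ = length (filter (λ { (r , c) → (leg μ r c ≟ 0) ×-dec (m ∣? suc (arm μ r c)) }) (cells μ))

-- Formal power series in t, q with ℕ coefficients:
-- F k n = coefficient of t^k q^n.

Series : Set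
Series = ℕ → ℕ → ℕ

ind : ∀ {P : Set} → Dec P → ℕ
ind (yes _) = 1
ind (no _)  = 0

sumTo : ℕ → (ℕ → ℕ) → ℕ
sumTo zero    f = f 0
sumTo (suc n) f = sumTo n f + f (suc n)

one : Series
one k n = ind ((k ≟ 0) ×-dec (n ≟ 0))

mono : ℕ → ℕ → Series
mono a b k n = ind ((k ≟ a) ×-dec (n ≟ b))

infixl 7 _⊛_
_⊛_ : Series → Series → Series
(F ⊛ G) k n = sumTo k (λ a → sumTo n (λ b → F a b * G (k ∸ a) (n ∸ b)))

-- 1 / (1 - t^a q^b) = Σ_j t^(a j) q^(b j), for b ≥ 1
-- (the index j ranges over 0..n, sufficient since b ≥ 1).
geom : ℕ → ℕ → Series
geom a b k n = sumTo n (λ j → ind ((a * j ≟ k) ×-dec (b * j ≟ n)))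

pow : Series → ℕ → Series
pow F zero    = one
pow F (suc e) = pow F e ⊛ F

prodTo : ℕ → (ℕ → Series) → Series
prodTo zero    f = one
prodTo (suc N) f = prodTo N f ⊛ f (suc N)

rhs1 : ℕ → List ℕ → ℕ → Series
rhs1 m λc N = mono 0 (size λc) ⊛ prodTo N (λ i → pow (geom 0 (m * i)) (m ∸ 1))

rhs2 : ℕ → List ℕ → ℕ → Series
rhs2 m λc N = mono 0 (size λc) ⊛ prodTo N (λ i → pow (geom 0 (m * i)) (m ∸ 1) ⊛ geom 1 (m * i))

{-# OPTIONS --safe #-}

-- Write m = k + 1 and draw μ with B ≥ |μ| rows (empty rows allowed) as beads on an abacus with m
-- runners.  Removing a rim hook of size m slides a bead one step down its runner, so the partitions
-- with core λ are those whose runners carry as many beads as the runners of λ; reading off the m runners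
-- separately (the m-quotient) shows that their generating function is q^|λ| ∏ (1 - q^(m i))^(-m).
-- On the other hand μ is given by the differences μᵣ - μᵣ₊₁, and dividing each of them by m splits μ
-- into an m-restricted partition with the same core and the list of quotients.  The latter is an
-- arbitrary partition scaled by m, and the sum of its entries is hm0 μ.  Cancelling the factor
-- ∏ (1 - q^(m i))^(-1) gives the restricted count, and remembering the sum of the quotients in the
-- exponent of t gives the second formula.
module Submission where

open import Defs
open import Data.Nat
open import Data.Nat.Properties
open import Data.Nat.DivMod
open import Data.Nat.Divisibility using (_∣_; divides)
open import Data.Nat.ListAction using (sum)
open import Data.Nat.Tactic.RingSolver using (solve-∀)
open import Data.Fin.Base using (Fin; zero; suc; inject₁; fromℕ; toℕ)
open import Data.Fin.Properties using (toℕ-inject₁; toℕ-fromℕ)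
open import Data.List.Base as List using (List; []; _∷_; length; filter; upTo; map; concatMap; _++_; cartesianProduct; allFin)
import Data.List.Properties as List
open import Data.List.Membership.Propositional using (_∈_)
open import Data.List.Membership.Propositional.Properties
open import Data.List.Membership.Propositional.Properties.WithK using (unique∧set⇒bag)
open import Data.List.Relation.Binary.BagAndSetEquality using (∼bag⇒↭)
open import Data.List.Relation.Binary.Permutation.Propositional.Properties using (↭-length)
open import Data.List.Relation.Unary.All as All using (All; []; _∷_)
open import Data.List.Relation.Unary.AllPairs using ([]; _∷_)
open import Data.List.Relation.Unary.Any using (here; there)
open import Data.List.Relation.Unary.Linked as Linked using (Linked; []; [-]; _∷_)
open import Data.List.Relation.Unary.Unique.Propositional using (Unique)
import Data.List.Relation.Unary.Unique.Propositional.Properties as Uniq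
open import Data.Vec.Base as Vec using (Vec; []; _∷_; _∷ʳ_; last; init; initLast; replicate; toList; lookup; zipWith)
import Data.Vec.Properties as Vec
open import Data.Vec.Relation.Unary.All as VAll using ([]; _∷_)
import Data.Vec.Relation.Unary.All.Properties as VAllP
open import Data.Product using (_×_; _,_; Σ; ∃; proj₁; proj₂)
open import Data.Sum using (_⊎_; inj₁; inj₂)
open import Data.Empty using (⊥; ⊥-elim)
open import Data.Unit using (⊤; tt)
open import Function using (id; _∘_)
open import Function.Bundles using (_⇔_; mk⇔; Equivalence)
open import Relation.Binary.Construct.Closure.ReflexiveTransitive using (Star; ε; _◅_)
open import Relation.Binary.Definitions using (tri<; tri≈; tri>)
open import Relation.Binary.PropositionalEquality
open import Relation.Nullary using (Dec; yes; no; ¬_)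
open import Relation.Nullary.Decidable using (_×-dec_)

-- Counting and power series

-- The products matter only modulo q^(N+1), and this fixes the number of rows: with m N empty rows
-- added to those of λ, every runner of λ carries at least N beads, so the bound that a runner puts
-- on the number of parts is invisible in degrees up to N. Configurations are compared through
-- `energy`, the sum of the bead positions, which is computed runner by runner, whereas the size is
-- not. The abacus is built without computing residues: raising all beads by one position rotates
-- the runners, and `runners` is a composite of such rotations. The vector `charge` of bead numbers
-- stands in for the core: rim hook removals preserve it, and a configuration without hooks of
-- length m is determined by it, which also yields uniqueness of the core.

record Card {A : Set} (P : A → Set) (n : ℕ) : Set where
  constructor mkCard
  field
    list     : List A
    unique   : Unique list
    sound    : ∀ {x} → x ∈ list → P x
    complete : ∀ {x} → P x → x ∈ list
    size≡    : length list ≡ n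

open Card

-- Duplicate-free lists with the same members are permutations of each other. The lists `L` of the
-- theorem are themselves such witnesses, so this is what turns a count into an equation.
Card-unique : ∀ {A : Set} {P : A → Set} {a b} → Card P a → Card P b → a ≡ b
Card-unique p q = trans (sym (size≡ p)) (trans (↭-length (∼bag⇒↭ (unique∧set⇒bag (unique p) (unique q)
  (mk⇔ (λ x → complete q (sound p x)) (λ x → complete p (sound q x)))))) (size≡ q))

Card-⇔ : ∀ {A : Set} {P Q : A → Set} {n} → (∀ {x} → P x → Q x) → (∀ {x} → Q x → P x) → Card P n → Card Q n
Card-⇔ f g (mkCard l u s c e) = mkCard l u (λ x → f (s x)) (λ x → c (g x)) e

map-unique : ∀ {A B : Set} {f : A → B} {l : List A} → (∀ {x y} → x ∈ l → y ∈ l → f x ≡ f y → x ≡ y) →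
  Unique l → Unique (map f l)
map-unique inj [] = []
map-unique {f = f} {x ∷ l} inj (x∉l ∷ u) =
  All.tabulate (λ y∈ fx≡y → let z , z∈l , y≡fz = ∈-map⁻ f y∈ in
    All.lookup x∉l z∈l (inj (here refl) (there z∈l) (trans fx≡y y≡fz)))
  ∷ map-unique (λ p q → inj (there p) (there q)) u

Card-bij : ∀ {A B : Set} {P : A → Set} {Q : B → Set} {n} (f : A → B) →
  (∀ {x} → P x → Q (f x)) → (∀ {x y} → P x → P y → f x ≡ f y → x ≡ y) →
  (∀ {y} → Q y → ∃ λ x → P x × f x ≡ y) → Card P n → Card Q n
Card-bij {Q = Q} f to inj surj p = mkCard (map f (list p))
  (map-unique (λ x y → inj (sound p x) (sound p y)) (unique p))
  (λ y∈ → let x , x∈ , e = ∈-map⁻ f y∈ in subst Q (sym e) (to (sound p x∈)))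
  (λ q → let x , px , e = surj q in subst (_∈ _) e (∈-map⁺ f (complete p px)))
  (trans (List.length-map f (list p)) (size≡ p))

Card-filter : ∀ {A : Set} {P Q : A → Set} {n} → (∀ x → Dec (Q x)) → Card P n → ∃ (Card (λ x → P x × Q x))
Card-filter Q? p = _ , mkCard (filter Q? (list p)) (Uniq.filter⁺ Q? (unique p))
  (λ x∈ → let y , q = ∈-filter⁻ Q? x∈ in sound p y , q)
  (λ (px , qx) → ∈-filter⁺ Q? (complete p px) qx) refl

Card-⊎ : ∀ {A : Set} {P Q : A → Set} {m n} → (∀ {x} → P x → ¬ Q x) → Card P m → Card Q n → Card (λ x → P x ⊎ Q x) (m + n)
Card-⊎ {P = P} {Q} dis p q = mkCard (list p ++ list q)
  (Uniq.++⁺ (unique p) (unique q) (λ (x , y) → dis (sound p x) (sound q y)))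
  snd
  (λ { (inj₁ x) → ∈-++⁺ˡ (complete p x) ; (inj₂ y) → ∈-++⁺ʳ (list p) (complete q y)})
  (trans (List.length-++ (list p)) (cong₂ _+_ (size≡ p) (size≡ q)))
  where
  snd : ∀ {x} → x ∈ list p ++ list q → P x ⊎ Q x
  snd x∈ with ∈-++⁻ (list p) x∈
  ... | inj₁ a = inj₁ (sound p a)
  ... | inj₂ b = inj₂ (sound q b)

length-cartesianProduct : ∀ {A B : Set} (xs : List A) (ys : List B) → length (cartesianProduct xs ys) ≡ length xs * length ys
length-cartesianProduct [] ys = refl
length-cartesianProduct (x ∷ xs) ys = trans (List.length-++ (map (x ,_) ys))
  (cong₂ _+_ (List.length-map (x ,_) ys) (length-cartesianProduct xs ys))

Card-× : ∀ {A B : Set} {P : A → Set} {Q : B → Set} {m n} → Card P m → Card Q n →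
  Card (λ ((x , y) : A × B) → P x × Q y) (m * n)
Card-× p q = mkCard (cartesianProduct (list p) (list q)) (Uniq.cartesianProduct⁺ (unique p) (unique q))
  (λ xy → let x , y = ∈-cartesianProduct⁻ (list p) (list q) xy in sound p x , sound q y)
  (λ (x , y) → ∈-cartesianProduct⁺ (complete p x) (complete q y))
  (trans (length-cartesianProduct (list p) (list q)) (cong₂ _*_ (size≡ p) (size≡ q)))

Card-ind : ∀ {A : Set} {P : Set} (a : A) (d : Dec P) → Card (λ x → x ≡ a × P) (ind d)
Card-ind a (yes p) = mkCard (a ∷ []) ([] ∷ []) (λ { (here e) → e , p }) (λ (e , _) → here e) refl
Card-ind a (no ¬p) = mkCard [] [] (λ ()) (λ (_ , p) → ⊥-elim (¬p p)) refl

Card-sumTo : ∀ {A : Set} (P : ℕ → A → Set) {c : ℕ → ℕ} n →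
  (∀ {i j x} → P i x → P j x → i ≡ j) → (∀ {i} → i ≤ n → Card (P i) (c i)) →
  Card (λ x → ∃ λ i → i ≤ n × P i x) (sumTo n c)
Card-sumTo P zero dis p = Card-⇔ (λ x → 0 , z≤n , x) (λ { (zero , _ , x) → x }) (p z≤n)
Card-sumTo P (suc n) dis p = Card-⇔
  (λ { (inj₁ (i , l , x)) → i , m≤n⇒m≤1+n l , x ; (inj₂ x) → suc n , ≤-refl , x })
  back
  (Card-⊎ (λ (i , l , x) y → <⇒≢ (s≤s l) (dis x y))
    (Card-sumTo P n dis (λ l → p (m≤n⇒m≤1+n l))) (p ≤-refl))
  where
  back : ∀ {x} → (∃ λ i → i ≤ suc n × P i x) → (∃ λ i → i ≤ n × P i x) ⊎ P (suc n) x
  back (i , l , x) with m≤n⇒m<n∨m≡n l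
  ... | inj₁ (s≤s l′) = inj₁ (i , l′ , x)
  ... | inj₂ refl     = inj₂ x

-- F is the generating function Σ t^(wt a) q^(wq a) over the a satisfying P.
GF : {A : Set} → (A → Set) → (A → ℕ) → (A → ℕ) → Series → Set
GF P wt wq F = ∀ k n → Card (λ a → P a × wt a ≡ k × wq a ≡ n) (F k n)

GF-⊛ : ∀ {A B : Set} {P : A → Set} {Q : B → Set} {wt wq vt vq F G} → GF P wt wq F → GF Q vt vq G →
  GF (λ ((a , b) : A × B) → P a × Q b) (λ (a , b) → wt a + vt b) (λ (a , b) → wq a + vq b) (F ⊛ G)
GF-⊛ {wt = wt} {wq} {vt} {vq} p q k n = Card-⇔
  (λ { (i , i≤k , j , j≤n , (pa , refl , refl) , (qb , e₁ , e₂)) → (pa , qb) ,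
       trans (cong (i +_) e₁) (m+[n∸m]≡n i≤k) , trans (cong (j +_) e₂) (m+[n∸m]≡n j≤n) })
  (λ { {a , b} ((pa , qb) , refl , refl) →
       wt a , m≤m+n _ _ , wq a , m≤m+n _ _ , (pa , refl , refl) ,
       (qb , sym (m+n∸m≡n (wt a) _) , sym (m+n∸m≡n (wq a) _)) })
  (Card-sumTo _ k (λ { (_ , _ , (_ , e , _) , _) (_ , _ , (_ , e′ , _) , _) → trans (sym e) e′ })
    (λ {i} _ → Card-sumTo _ n (λ { ((_ , _ , e) , _) ((_ , _ , e′) , _) → trans (sym e) e′ })
      (λ {j} _ → Card-× (p i j) (q (k ∸ i) (n ∸ j)))))

infix 4 _≈[_]_

-- Equality of power series modulo q^(N+1).
_≈[_]_ : Series → ℕ → Series → Set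
F ≈[ N ] G = ∀ k n → n ≤ N → F k n ≡ G k n

≈-refl : ∀ {N F} → F ≈[ N ] F
≈-refl k n l = refl

≈-sym : ∀ {N F G} → F ≈[ N ] G → G ≈[ N ] F
≈-sym p k n l = sym (p k n l)

≈-trans : ∀ {N F G H} → F ≈[ N ] G → G ≈[ N ] H → F ≈[ N ] H
≈-trans p q k n l = trans (p k n l) (q k n l)

-- Weights are compared for `f` only: those of `g b` follow from `f (g b) ≡ b`.
GF-bij : ∀ {A B : Set} {P : A → Set} {Q : B → Set} {wt wq vt vq F} → GF P wt wq F → (f : A → B) (g : B → A) →
  (∀ {a} → P a → Q (f a) × vt (f a) ≡ wt a × vq (f a) ≡ wq a × g (f a) ≡ a) →
  (∀ {b} → Q b → P (g b) × f (g b) ≡ b) → GF Q vt vq F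
GF-bij {vt = vt} {vq} p f g fw bw k n = Card-bij f
  (λ { (pa , refl , refl) → let qa , e₁ , e₂ , _ = fw pa in qa , e₁ , e₂ })
  (λ { (pa , _) (pb , _) e → trans (sym (proj₂ (proj₂ (proj₂ (fw pa))))) (trans (cong g e) (proj₂ (proj₂ (proj₂ (fw pb))))) })
  (λ { {b} (qb , refl , refl) → let pa , e = bw qb in
       g b , (pa , trans (sym (proj₁ (proj₂ (fw pa)))) (cong vt e) , trans (sym (proj₁ (proj₂ (proj₂ (fw pa))))) (cong vq e)) , e })
  (p k n)

GF-unique : ∀ {A : Set} {P : A → Set} {wt wq F G N} → GF P wt wq F → GF P wt wq G → F ≈[ N ] G
GF-unique p q k n _ = Card-unique (p k n) (q k n)

GF-≈ : ∀ {A B : Set} {P : A → Set} {Q : B → Set} {wt wq vt vq F G N} →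
  GF P wt wq F → GF Q vt vq G → (f : A → B) (g : B → A) →
  (∀ {a} → P a → Q (f a) × vt (f a) ≡ wt a × vq (f a) ≡ wq a × g (f a) ≡ a) →
  (∀ {b} → Q b → P (g b) × f (g b) ≡ b) → F ≈[ N ] G
GF-≈ p q f g fw bw = GF-unique (GF-bij p f g fw bw) q

-- Every series counts something; this makes the ring laws consequences of bijections.
Model : Series → Set
Model F = Σ ℕ λ k → Σ ℕ λ n → Fin (F k n)

model : ∀ F → GF {Model F} (λ _ → ⊤) proj₁ (λ a → proj₁ (proj₂ a)) F
model F k n = Card-bij {P = λ _ → ⊤} (λ i → k , n , i) (λ _ → tt , refl , refl) (λ { _ _ refl → refl })
  (λ { {_ , _ , i} (_ , refl , refl) → i , tt , refl })
  (mkCard (allFin (F k n)) (Uniq.allFin⁺ _) (λ _ → tt) (λ _ → ∈-allFin _) (List.length-tabulate _))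

⊛-comm : ∀ {N} F G → F ⊛ G ≈[ N ] G ⊛ F
⊛-comm F G = GF-≈ (GF-⊛ (model F) (model G)) (GF-⊛ (model G) (model F))
  (λ (a , b) → b , a) (λ (a , b) → b , a)
  (λ {(a , b)} _ → _ , +-comm (proj₁ b) _ , +-comm (proj₁ (proj₂ b)) _ , refl) (λ _ → _ , refl)

⊛-assoc : ∀ {N} F G H → (F ⊛ G) ⊛ H ≈[ N ] F ⊛ (G ⊛ H)
⊛-assoc F G H = GF-≈ (GF-⊛ (GF-⊛ (model F) (model G)) (model H)) (GF-⊛ (model F) (GF-⊛ (model G) (model H)))
  (λ ((a , b) , c) → a , b , c) (λ (a , b , c) → (a , b) , c)
  (λ {((a , b) , c)} _ → _ , sym (+-assoc (proj₁ a) _ _) , sym (+-assoc (proj₁ (proj₂ a)) _ _) , refl) (λ _ → _ , refl)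

sumTo-cong : ∀ n {f g : ℕ → ℕ} → (∀ i → i ≤ n → f i ≡ g i) → sumTo n f ≡ sumTo n g
sumTo-cong zero e = e 0 z≤n
sumTo-cong (suc n) e = cong₂ _+_ (sumTo-cong n (λ i l → e i (m≤n⇒m≤1+n l))) (e (suc n) ≤-refl)

⊛-cong : ∀ {N F F′ G G′} → F ≈[ N ] F′ → G ≈[ N ] G′ → F ⊛ G ≈[ N ] F′ ⊛ G′
⊛-cong p q k n l = sumTo-cong k (λ a _ → sumTo-cong n (λ b b≤n →
  cong₂ _*_ (p a b (≤-trans b≤n l)) (q (k ∸ a) (n ∸ b) (≤-trans (m∸n≤m n b) l))))

⊛-interchange : ∀ {N} F G H K → (F ⊛ G) ⊛ (H ⊛ K) ≈[ N ] (F ⊛ H) ⊛ (G ⊛ K)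
⊛-interchange F G H K = GF-≈
  (GF-⊛ (GF-⊛ (model F) (model G)) (GF-⊛ (model H) (model K)))
  (GF-⊛ (GF-⊛ (model F) (model H)) (GF-⊛ (model G) (model K)))
  (λ ((a , b) , (c , d)) → (a , c) , (b , d)) (λ ((a , b) , (c , d)) → (a , c) , (b , d))
  (λ {((a , b) , (c , d))} _ → _ , lem (proj₁ a) (proj₁ c) _ _ , lem (proj₁ (proj₂ a)) (proj₁ (proj₂ c)) _ _ , refl) (λ _ → _ , refl)
  where
  lem : ∀ a c b d → (a + c) + (b + d) ≡ (a + b) + (c + d)
  lem = solve-∀

ind-⇔ : ∀ {P Q : Set} (d : Dec P) (e : Dec Q) → (P → Q) → (Q → P) → ind d ≡ ind e
ind-⇔ (yes _) (yes _) _ _ = refl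
ind-⇔ (yes p) (no ¬q) f _ = ⊥-elim (¬q (f p))
ind-⇔ (no ¬p) (yes q) _ g = ⊥-elim (¬p (g q))
ind-⇔ (no _)  (no _)  _ _ = refl

GF-mono : ∀ a b → GF {⊤} (λ _ → ⊤) (λ _ → a) (λ _ → b) (mono a b)
GF-mono a b k n = Card-⇔ (λ (_ , e , e′) → tt , sym e , sym e′) (λ (_ , e , e′) → refl , sym e , sym e′)
  (Card-ind tt ((k ≟ a) ×-dec (n ≟ b)))

GF-one : GF {⊤} (λ _ → ⊤) (λ _ → 0) (λ _ → 0) one
GF-one = GF-mono 0 0

GF-geom : ∀ a b → 0 < b → GF {ℕ} (λ _ → ⊤) (a *_) (b *_) (geom a b)
GF-geom a b@(suc b′) _ k n = Card-⇔
  (λ { (i , _ , refl , e , e′) → tt , e , e′ })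
  -- Since `b` is positive, `i` is at most `b * i`, so the truncation of the sum in `geom` loses
  -- nothing.
  (λ { {i} (_ , e , e′) → i , ≤-trans (m≤m+n i (b′ * i)) (≤-reflexive e′) , refl , e , e′ })
  (Card-sumTo _ n (λ (e , _) (e′ , _) → trans (sym e) e′) (λ {i} _ → Card-ind i ((a * i ≟ k) ×-dec (b * i ≟ n))))

⊛-identityˡ : ∀ {N} F → one ⊛ F ≈[ N ] F
⊛-identityˡ F = GF-≈ (GF-⊛ GF-one (model F)) (model F) proj₂ (λ a → tt , a) (λ _ → _ , refl , refl , refl) (λ _ → _ , refl)

⊛-identityʳ : ∀ {N} F → F ⊛ one ≈[ N ] F
⊛-identityʳ F = ≈-trans (⊛-comm F one) (⊛-identityˡ F)

prodTo-cong : ∀ {N} M {f g : ℕ → Series} → (∀ i → f i ≈[ N ] g i) → prodTo M f ≈[ N ] prodTo M g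
prodTo-cong zero e = ≈-refl
prodTo-cong (suc M) e = ⊛-cong (prodTo-cong M e) (e (suc M))

prodTo-⊛ : ∀ {N} M (f g : ℕ → Series) → prodTo M (λ i → f i ⊛ g i) ≈[ N ] prodTo M f ⊛ prodTo M g
prodTo-⊛ zero f g = ≈-sym (⊛-identityˡ one)
prodTo-⊛ (suc M) f g = ≈-trans (⊛-cong {G = f (suc M) ⊛ g (suc M)} (prodTo-⊛ M f g) ≈-refl)
  (⊛-interchange (prodTo M f) (prodTo M g) (f (suc M)) (g (suc M)))

prodTo-one : ∀ {N} M → prodTo M (λ _ → one) ≈[ N ] one
prodTo-one zero = ≈-refl
prodTo-one (suc M) = ≈-trans (⊛-identityʳ _) (prodTo-one M)

prodTo-pow : ∀ {N} M (f : ℕ → Series) e → prodTo M (λ i → pow (f i) e) ≈[ N ] pow (prodTo M f) e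
prodTo-pow M f zero = prodTo-one M
prodTo-pow M f (suc e) = ≈-trans (prodTo-⊛ M (λ i → pow (f i) e) f) (⊛-cong {G = prodTo M f} (prodTo-pow M f e) ≈-refl)

-- Stability of the partial products, which lets N factors stand for the infinite product.
prodTo-extend : ∀ {N M} (f : ℕ → Series) → N ≤′ M → (∀ i → N < i → f i ≈[ N ] one) → prodTo M f ≈[ N ] prodTo N f
prodTo-extend f ≤′-refl e = ≈-refl
prodTo-extend f (≤′-step l) e = ≈-trans (⊛-cong (prodTo-extend f l e) (e _ (s≤s (≤′⇒≤ l)))) (⊛-identityʳ _)

sumTo-0 : ∀ n {f : ℕ → ℕ} → (∀ i → 0 < i → i ≤ n → f i ≡ 0) → sumTo n f ≡ f 0
sumTo-0 zero e = refl
sumTo-0 (suc n) {f} e = trans (cong₂ _+_ (sumTo-0 n (λ i p l → e i p (m≤n⇒m≤1+n l))) (e (suc n) z<s ≤-refl)) (+-identityʳ (f 0))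

geom≈one : ∀ {N} a b → N < b → geom a b ≈[ N ] one
geom≈one {N} a b N<b k n n≤N = trans
  -- Comparison with a decision of `⊥` evaluates the indicator to 0: a term with positive `i` has
  -- q-degree at least `b`, which exceeds `n`.
  (sumTo-0 n (λ { i@(suc i′) _ _ → ind-⇔ ((a * i ≟ k) ×-dec (b * i ≟ n)) (no (λ (x : ⊥) → x))
     (λ (_ , e) → <⇒≢ (<-≤-trans (≤-<-trans n≤N N<b) (m≤m*n b i)) (sym e)) (λ ()) }))
  (ind-⇔ ((a * 0 ≟ k) ×-dec (b * 0 ≟ n)) ((k ≟ 0) ×-dec (n ≟ 0))
    (λ (e , e′) → trans (sym e) (*-zeroʳ a) , trans (sym e′) (*-zeroʳ b))
    (λ (e , e′) → trans (*-zeroʳ a) (sym e) , trans (*-zeroʳ b) (sym e′)))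

-- Cancelling a series with constant term 1

Monic : Series → Set
Monic G = ∀ k → G k 0 ≡ ind (k ≟ 0)

Monic-one : Monic one
Monic-one k = ind-⇔ ((k ≟ 0) ×-dec (0 ≟ 0)) (k ≟ 0) proj₁ (λ e → e , refl)

Monic-≈ : ∀ {F G} → F ≈[ 0 ] G → Monic G → Monic F
Monic-≈ e p k = trans (e k 0 z≤n) (p k)

Monic-prodTo : ∀ M {f} → (∀ i → 0 < i → f i ≈[ 0 ] one) → Monic (prodTo M f)
Monic-prodTo M {f} e = Monic-≈ (prodTo-extend f (z≤′n {M}) e) Monic-one

sumTo-last : ∀ n {f : ℕ → ℕ} → (∀ i → i < n → f i ≡ 0) → sumTo n f ≡ f n
sumTo-last zero e = refl
sumTo-last (suc n) {f} e = cong (_+ f (suc n)) (trans (sumTo-last n (λ i l → e i (m≤n⇒m≤1+n l))) (e n ≤-refl))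

sumTo-+ : ∀ n (f g : ℕ → ℕ) → sumTo n (λ i → f i + g i) ≡ sumTo n f + sumTo n g
sumTo-+ zero f g = refl
sumTo-+ (suc n) f g = trans (cong (_+ (f (suc n) + g (suc n))) (sumTo-+ n f g)) (lem (sumTo n f) (sumTo n g) (f (suc n)) (g (suc n)))
  where
  lem : ∀ a b c d → a + b + (c + d) ≡ a + c + (b + d)
  lem = solve-∀

-- The part of the coefficient of a product in which the first factor has q-degree below n.
lowTerms : Series → Series → Series
lowTerms F G k zero    = 0
lowTerms F G k (suc n) = sumTo k (λ a → sumTo n (λ b → F a b * G (k ∸ a) (suc n ∸ b)))

-- Isolates the terms in which `F` contributes its coefficients of q-degree n. The other factor then
-- has q-degree 0, and monicity leaves the single term `a = k`.
⊛-monic : ∀ F G → Monic G → ∀ k n → (F ⊛ G) k n ≡ lowTerms F G k n + F k n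
⊛-monic F G mon k n = trans (split n) (cong (lowTerms F G k n +_) top)
  where
  top : sumTo k (λ a → F a n * G (k ∸ a) 0) ≡ F k n
  top = trans (sumTo-last k (λ a a<k → trans (cong (F a n *_) (trans (mon (k ∸ a)) (ind-⇔ (k ∸ a ≟ 0) (no (λ (x : ⊥) → x)) (λ e → <⇒≢ (m<n⇒0<n∸m a<k) (sym e)) (λ ())))) (*-zeroʳ (F a n))))
    (trans (cong (F k n *_) (trans (mon (k ∸ k)) (ind-⇔ (k ∸ k ≟ 0) (yes tt) (λ _ → tt) (λ _ → n∸n≡0 k)))) (*-identityʳ (F k n)))
  split : ∀ n → (F ⊛ G) k n ≡ lowTerms F G k n + sumTo k (λ a → F a n * G (k ∸ a) 0)
  split zero = refl
  split (suc n) = trans (sumTo-+ k _ _)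
    (cong (lowTerms F G k (suc n) +_) (sumTo-cong k (λ a _ → cong (λ z → F a (suc n) * G (k ∸ a) z) (n∸n≡0 n))))

-- Induction on the q-degree: once the lower coefficients agree, so do the `lowTerms`, and
-- cancelling these sums replaces division by a power series.
⊛-cancelʳ : ∀ {N F F′ G} → Monic G → F ⊛ G ≈[ N ] F′ ⊛ G → F ≈[ N ] F′
⊛-cancelʳ {N} {F} {F′} {G} mon e k n n≤N = go n n≤N k n ≤-refl
  where
  peel : ∀ k n → n ≤ N → lowTerms F G k n ≡ lowTerms F′ G k n → F k n ≡ F′ k n
  peel k n l eq = +-cancelˡ-≡ (lowTerms F G k n) _ _ (trans (sym (⊛-monic F G mon k n))
    (trans (e k n l) (trans (⊛-monic F′ G mon k n) (cong (_+ F′ k n) (sym eq)))))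
  go : ∀ n → n ≤ N → F ≈[ n ] F′
  go zero    l k zero _ = peel k 0 l refl
  go (suc n) l k i i≤ with m≤n⇒m<n∨m≡n i≤
  ... | inj₁ (s≤s i≤n) = go n (≤-trans (n≤1+n n) l) k i i≤n
  ... | inj₂ refl = peel k i l (sumTo-cong k (λ a _ → sumTo-cong n (λ b b≤n →
          cong (_* G (k ∸ a) (suc n ∸ b)) (go n (≤-trans (n≤1+n n) l) a b b≤n))))

-- The abacus

snoc-elim : ∀ {A : Set} {k} (P : Vec A (suc k) → Set) → (∀ xs x → P (xs ∷ʳ x)) → ∀ v → P v
snoc-elim P p v = let xs , x , e = initLast v in subst P (sym e) (p xs x)

-- Raising every bead by one position sends each runner to the next, except that the last becomes
-- runner 0 with its beads one level higher; `f` is the effect of that extra level.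
rot : ∀ {A : Set} {k} → (A → A) → Vec A (suc k) → Vec A (suc k)
rot f v = f (last v) ∷ init v

rot-∷ʳ : ∀ {A : Set} {k} (f : A → A) (xs : Vec A k) x → rot f (xs ∷ʳ x) ≡ f x ∷ xs
rot-∷ʳ f xs x = cong₂ _∷_ (cong f (Vec.last-∷ʳ x xs)) (Vec.init-∷ʳ x xs)

map-rot : ∀ {A B : Set} {k} (g : A → B) (f : A → A) (f′ : B → B) → (∀ x → g (f x) ≡ f′ (g x)) →
  ∀ (v : Vec A (suc k)) → Vec.map g (rot f v) ≡ rot f′ (Vec.map g v)
map-rot g f f′ e = snoc-elim _ λ xs x →
  trans (cong (Vec.map g) (rot-∷ʳ f xs x))
  (trans (cong (_∷ Vec.map g xs) (e x))
  (trans (sym (rot-∷ʳ f′ (Vec.map g xs) (g x))) (cong (rot f′) (sym (Vec.map-∷ʳ g x xs)))))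

rot-injective : ∀ {A : Set} {k} {f : A → A} → (∀ {x y} → f x ≡ f y → x ≡ y) →
  ∀ (v w : Vec A (suc k)) → rot f v ≡ rot f w → v ≡ w
rot-injective {f = f} inj = snoc-elim _ λ xs x → snoc-elim _ λ ys y e →
  let e′ = trans (sym (rot-∷ʳ f xs x)) (trans e (rot-∷ʳ f ys y)) in
  cong₂ _∷ʳ_ (Vec.∷-injectiveʳ e′) (inj (Vec.∷-injectiveˡ e′))

rotN : ∀ {A : Set} {k} → (A → A) → ℕ → Vec A (suc k) → Vec A (suc k)
rotN f zero    v = v
rotN f (suc n) v = rot f (rotN f n v)

toList-rot : ∀ {A : Set} {k} (f : A → A) (v : Vec A (suc k)) zs z → toList v ≡ zs ++ z ∷ [] → toList (rot f v) ≡ f z ∷ zs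
toList-rot f = snoc-elim _ λ xs x zs z e →
  let e₁ , e₂ = List.∷ʳ-injective (toList xs) zs (trans (sym (Vec.toList-∷ʳ x xs)) e) in
  trans (cong toList (rot-∷ʳ f xs x)) (cong₂ (λ a b → f a ∷ b) e₂ e₁)

-- Lists allow an induction over an arbitrary splitting of the entries; for vectors the lengths
-- would have to be cast.
toList-rotN : ∀ {A : Set} {k} (f : A → A) (xs ys : List A) (v : Vec A (suc k)) → toList v ≡ xs ++ ys →
  toList (rotN f (length ys) v) ≡ List.map f ys ++ xs
toList-rotN f xs []       v e = trans e (List.++-identityʳ xs)
toList-rotN f xs (y ∷ ys) v e = toList-rot f _ (List.map f ys ++ xs) y
  (trans (toList-rotN f (xs ++ y ∷ []) ys v (trans e (sym (List.++-assoc xs (y ∷ []) ys))))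
    (sym (List.++-assoc (List.map f ys) xs (y ∷ []))))

-- m steps in position are one level on every runner. The case `id` gives the period of the abacus,
-- the case `suc` the effect of m new empty rows on the charge.
rotN-full : ∀ {A : Set} {k} (f : A → A) (v : Vec A (suc k)) → rotN f (suc k) v ≡ Vec.map f v
rotN-full {k = k} f v = trans (sym (Vec.cast-is-id refl _)) (Vec.toList-injective refl _ _
  (trans (cong (λ n → toList (rotN f n v)) (sym (Vec.length-toList v)))
  (trans (toList-rotN f [] (toList v) v refl)
  (trans (List.++-identityʳ _) (sym (Vec.toList-map f v))))))

inc : List ℕ → List ℕ
inc []       = []
inc (x ∷ xs) = suc x ∷ xs

inc-injective : ∀ {xs ys} → inc xs ≡ inc ys → xs ≡ ys
inc-injective {[]} {[]} e = refl
inc-injective {x ∷ xs} {y ∷ ys} refl = refl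

0∷≢inc : ∀ {t} s → 0 ∷ t ≢ inc s
0∷≢inc []      ()
0∷≢inc (_ ∷ _) ()

length-inc : ∀ xs → length (inc xs) ≡ length xs
length-inc []       = refl
length-inc (x ∷ xs) = refl

-- A list d of length B encodes B beads: its entries are the gaps below the successive beads,
-- lowest bead first.  Runner i of the abacus carries the beads whose position is i modulo suc k.
runners : ∀ {k} → List ℕ → Vec (List ℕ) (suc k)
runners []          = replicate _ []
runners (zero  ∷ d) = rot (0 ∷_) (runners d)
runners (suc x ∷ d) = rot inc (runners (x ∷ d))

charge : ∀ k → List ℕ → Vec ℕ (suc k)
charge k d = Vec.map length (runners {k} d)

charge-0∷ : ∀ {k} d → charge k (0 ∷ d) ≡ rot suc (charge k d)
charge-0∷ d = map-rot length (0 ∷_) suc (λ _ → refl) (runners d)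

charge-suc∷ : ∀ {k} x d → charge k (suc x ∷ d) ≡ rot id (charge k (x ∷ d))
charge-suc∷ x d = map-rot length inc id length-inc (runners (x ∷ d))

-- The gap enters only as a number of rotations, so only its residue modulo m matters; this is why
-- dividing the gaps by m preserves the charge.
charge-∷ : ∀ {k} x d → charge k (x ∷ d) ≡ rotN id x (rot suc (charge k d))
charge-∷ zero    d = charge-0∷ d
charge-∷ (suc x) d = trans (charge-suc∷ x d) (cong (rot id) (charge-∷ x d))

rotN-+ : ∀ {A : Set} {k} (f : A → A) a b (v : Vec A (suc k)) → rotN f (a + b) v ≡ rotN f a (rotN f b v)
rotN-+ f zero    b v = refl
rotN-+ f (suc a) b v = cong (rot f) (rotN-+ f a b v)

rotN-period : ∀ {A : Set} {k} (v : Vec A (suc k)) → rotN id (suc k) v ≡ v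
rotN-period v = trans (rotN-full id v) (Vec.map-id v)

rotN-periods : ∀ {A : Set} {k} e (v : Vec A (suc k)) → rotN id (e * suc k) v ≡ v
rotN-periods zero    v = refl
rotN-periods {k = k} (suc e) v = trans (rotN-+ id (suc k) (e * suc k) v) (trans (rotN-period _) (rotN-periods e v))

-- A gap `x` raises its own bead and the `length d` beads above it, so the result is the size of the
-- partition with these row differences.
gapSize : List ℕ → ℕ
gapSize []      = 0
gapSize (x ∷ d) = x * suc (length d) + gapSize d

triangle : ℕ → ℕ
triangle zero    = 0
triangle (suc n) = n + triangle n

-- The sum of the bead positions; `triangle` is its value when all beads are packed at the bottom.
energy : List ℕ → ℕ
energy d = gapSize d + triangle (length d)

energy-0∷ : ∀ d → energy (0 ∷ d) ≡ length d + energy d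
energy-0∷ d = lem (gapSize d) (length d) (triangle (length d))
  where
  lem : ∀ a b c → a + (b + c) ≡ b + (a + c)
  lem = solve-∀

energy-suc∷ : ∀ x d → energy (suc x ∷ d) ≡ suc (length d) + energy (x ∷ d)
energy-suc∷ x d = lem (length d) (x * suc (length d)) (gapSize d) (length d + triangle (length d))
  where
  lem : ∀ l a b c → suc l + a + b + c ≡ suc l + (a + b + c)
  lem = solve-∀

energy-inc : ∀ xs → energy (inc xs) ≡ length xs + energy xs
energy-inc []       = refl
energy-inc (x ∷ xs) = energy-suc∷ x xs

total : ∀ {n} → Vec (List ℕ) n → ℕ
total []       = 0
total (δ ∷ δs) = length δ + total δs

total-∷ʳ : ∀ {n} (δs : Vec (List ℕ) n) δ → total (δs ∷ʳ δ) ≡ length δ + total δs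
total-∷ʳ []        δ = refl
total-∷ʳ (δ′ ∷ δs) δ = trans (cong (length δ′ +_) (total-∷ʳ δs δ)) (lem (length δ′) (length δ) (total δs))
  where
  lem : ∀ a b c → a + (b + c) ≡ b + (a + c)
  lem = solve-∀

-- A bead at position p on runner i sits at position i + m p of the whole configuration.
energies : ∀ {n} → ℕ → ℕ → Vec (List ℕ) n → ℕ
energies m i []       = 0
energies m i (δ ∷ δs) = i * length δ + m * energy δ + energies m (suc i) δs

energies-∷ʳ : ∀ {n} m i (δs : Vec (List ℕ) n) δ →
  energies m i (δs ∷ʳ δ) ≡ energies m i δs + ((n + i) * length δ + m * energy δ)
energies-∷ʳ m i [] δ = +-identityʳ _
energies-∷ʳ {suc n} m i (δ′ ∷ δs) δ = trans (cong (i * length δ′ + m * energy δ′ +_) (energies-∷ʳ m (suc i) δs δ))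
  (trans (cong (λ z → i * length δ′ + m * energy δ′ + (energies m (suc i) δs + (z * length δ + m * energy δ))) (+-suc n i))
    (sym (+-assoc (i * length δ′ + m * energy δ′) (energies m (suc i) δs) _)))

energies-suc : ∀ {n} m i (δs : Vec (List ℕ) n) → energies m (suc i) δs ≡ energies m i δs + total δs
energies-suc m i [] = refl
energies-suc m i (δ ∷ δs) = trans (cong (suc i * length δ + m * energy δ +_) (energies-suc m (suc i) δs))
  (lem i (length δ) (m * energy δ) (energies m (suc i) δs) (total δs))
  where
  lem : ∀ i l a e t → suc i * l + a + (e + t) ≡ i * l + a + e + (l + t)
  lem = solve-∀

-- Each bead rises by one position. For the last runner, index k drops to index 0 while `f` adds one
-- level, worth m: a net gain of 1 again.
energies-rot : ∀ {k} (f : List ℕ → List ℕ) → (∀ δ → energy (f δ) ≡ length δ + energy δ) →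
  ∀ (v : Vec (List ℕ) (suc k)) → energies (suc k) 0 (rot f v) ≡ energies (suc k) 0 v + total v
energies-rot {k} f p = snoc-elim _ λ xs x → begin
  energies (suc k) 0 (rot f (xs ∷ʳ x))
    ≡⟨ cong (energies (suc k) 0) (rot-∷ʳ f xs x) ⟩
  suc k * energy (f x) + energies (suc k) 1 xs
    ≡⟨ cong₂ (λ a b → suc k * a + b) (p x) (energies-suc (suc k) 0 xs) ⟩
  suc k * (length x + energy x) + (energies (suc k) 0 xs + total xs)
    ≡⟨ lem k (length x) (energy x) (energies (suc k) 0 xs) (total xs) ⟩
  energies (suc k) 0 xs + ((k + 0) * length x + suc k * energy x) + (length x + total xs)
    ≡⟨ cong₂ _+_ (energies-∷ʳ (suc k) 0 xs x) (total-∷ʳ xs x) ⟨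
  energies (suc k) 0 (xs ∷ʳ x) + total (xs ∷ʳ x) ∎
  where
  open ≡-Reasoning
  lem : ∀ k l e a t → suc k * (l + e) + (a + t) ≡ a + ((k + 0) * l + suc k * e) + (l + t)
  lem = solve-∀

total-rot : ∀ {k} (f : List ℕ → List ℕ) c → (∀ δ → length (f δ) ≡ c + length δ) →
  ∀ (v : Vec (List ℕ) (suc k)) → total (rot f v) ≡ c + total v
total-rot f c p = snoc-elim _ λ xs x →
  trans (cong total (rot-∷ʳ f xs x)) (trans (cong (_+ total xs) (p x))
  (trans (+-assoc c (length x) _) (cong (c +_) (sym (total-∷ʳ xs x)))))

total-[] : ∀ n → total (replicate n []) ≡ 0
total-[] zero    = refl
total-[] (suc n) = total-[] n

total-runners : ∀ {k} d → total (runners {k} d) ≡ length d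
total-runners {k} []      = total-[] (suc k)
total-runners {k} (zero  ∷ d) = trans (total-rot (0 ∷_) 1 (λ _ → refl) (runners {k} d)) (cong suc (total-runners {k} d))
total-runners {k} (suc x ∷ d) = trans (total-rot inc 0 length-inc (runners {k} (x ∷ d))) (total-runners {k} (x ∷ d))

energies-[] : ∀ m i n → energies m i (replicate n []) ≡ 0
energies-[] m i zero    = refl
energies-[] m i (suc n) = cong₂ _+_ (cong₂ _+_ (*-zeroʳ i) (*-zeroʳ m)) (energies-[] m (suc i) n)

energies-runners : ∀ {k} d → energies (suc k) 0 (runners {k} d) ≡ energy d
energies-runners {k} []          = energies-[] (suc k) 0 (suc k)
energies-runners {k} (zero  ∷ d) = trans (energies-rot (0 ∷_) energy-0∷ (runners d))
  (trans (cong₂ _+_ (energies-runners {k} d) (total-runners {k} d)) (trans (+-comm (energy d) _) (sym (energy-0∷ d))))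
energies-runners {k} (suc x ∷ d) = trans (energies-rot inc energy-inc (runners (x ∷ d)))
  (trans (cong₂ _+_ (energies-runners {k} (x ∷ d)) (total-runners {k} (x ∷ d))) (trans (+-comm (energy (x ∷ d)) _) (sym (energy-suc∷ x d))))

-- Runner 0 shows whether position 0 is occupied, so the constructors of `d` can be recovered one at
-- a time.
runners-injective : ∀ {k} d d′ → runners {k} d ≡ runners d′ → d ≡ d′
runners-injective [] [] e = refl
runners-injective {k} [] (x ∷ d′) e =
  ⊥-elim (0≢1+n (trans (sym (total-runners {k} [])) (trans (cong total e) (total-runners {k} (x ∷ d′)))))
runners-injective {k} (x ∷ d) [] e =
  ⊥-elim (1+n≢0 (trans (sym (total-runners {k} (x ∷ d))) (trans (cong total e) (total-runners {k} []))))
runners-injective (zero ∷ d) (zero ∷ d′) e =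
  cong (0 ∷_) (runners-injective d d′ (rot-injective List.∷-injectiveʳ _ _ e))
runners-injective {k} (zero ∷ d) (suc x′ ∷ d′) e = ⊥-elim (0∷≢inc _ (Vec.∷-injectiveˡ e))
runners-injective (suc x ∷ d) (zero ∷ d′) e = ⊥-elim (0∷≢inc _ (sym (Vec.∷-injectiveˡ e)))
runners-injective (suc x ∷ d) (suc x′ ∷ d′) e
  with refl ← runners-injective (x ∷ d) (x′ ∷ d′) (rot-injective inc-injective _ _ e) = refl

total≡0 : ∀ {n} (v : Vec (List ℕ) n) → total v ≡ 0 → v ≡ replicate n []
total≡0 []       _ = refl
total≡0 ([] ∷ v) e = cong ([] ∷_) (total≡0 v e)

-- Induction on energy plus number of beads: peeling off position 0 of the abacus lowers it.
runners-surjective′ : ∀ {k} n (v : Vec (List ℕ) (suc k)) → energies (suc k) 0 v + total v ≤ n → ∃ λ d → runners d ≡ v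
-- The case of an empty position 0, where all beads are lowered by one. Without a bead the measure
-- would not drop, hence the hypothesis on `total`.
runners-shift : ∀ {k} n (w : Vec (List ℕ) (suc k)) → energies (suc k) 0 (rot inc w) + total (rot inc w) ≤ n → total w ≢ 0 →
  ∃ λ d → runners d ≡ rot inc w

runners-surjective′ {k} n ((zero ∷ δ) ∷ δs) l = go n (subst (_≤ n) lem l)
  where
  w : Vec (List ℕ) (suc k)
  w = δs ∷ʳ δ
  e : rot (0 ∷_) w ≡ (zero ∷ δ) ∷ δs
  e = rot-∷ʳ (0 ∷_) δs δ
  lem : energies (suc k) 0 ((zero ∷ δ) ∷ δs) + total ((zero ∷ δ) ∷ δs) ≡ (energies (suc k) 0 w + total w) + suc (total w)
  lem = trans (cong (λ v → energies (suc k) 0 v + total v) (sym e))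
    (cong₂ _+_ (energies-rot (0 ∷_) energy-0∷ w) (total-rot (0 ∷_) 1 (λ _ → refl) w))
  go : ∀ n → (energies (suc k) 0 w + total w) + suc (total w) ≤ n → _
  go zero    l′ = ⊥-elim (1+n≢0 (n≤0⇒n≡0 (≤-trans (≤-reflexive (sym (+-suc _ (total w)))) l′)))
  go (suc n) l′ = let d , p = runners-surjective′ n w (≤-trans (m≤m+n _ (total w)) (s≤s⁻¹ (≤-trans (≤-reflexive (sym (+-suc _ (total w)))) l′)))
    in 0 ∷ d , trans (cong (rot (0 ∷_)) p) e
runners-surjective′ {k} n v@((suc x ∷ δ) ∷ δs) l =
  let e = rot-∷ʳ inc δs (x ∷ δ)
      d , p = runners-shift n (δs ∷ʳ (x ∷ δ)) (subst (λ v → energies (suc k) 0 v + total v ≤ n) (sym e) l)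
                (λ q → 1+n≢0 (trans (sym (total-∷ʳ δs (x ∷ δ))) q))
  in d , trans p e
-- An empty runner 0 equals `inc []`, so the configuration is a shift unless there are no beads at
-- all.
runners-surjective′ {k} n ([] ∷ δs) l with total δs ≟ 0
... | yes q = [] , cong ([] ∷_) (sym (total≡0 δs q))
... | no ¬q =
  let e = rot-∷ʳ inc δs []
      d , p = runners-shift n (δs ∷ʳ []) (subst (λ v → energies (suc k) 0 v + total v ≤ n) (sym e) l)
                (λ q → ¬q (trans (sym (total-∷ʳ δs [])) q))
  in d , trans p e

runners-shift {k} n w l t≢0 = go n (subst (_≤ n) lem l)
  where
  lem : energies (suc k) 0 (rot inc w) + total (rot inc w) ≡ (energies (suc k) 0 w + total w) + total w
  lem = cong₂ _+_ (energies-rot inc energy-inc w) (total-rot inc 0 length-inc w)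
  go : ∀ n → (energies (suc k) 0 w + total w) + total w ≤ n → _
  go zero l′ = ⊥-elim (t≢0 (m+n≡0⇒n≡0 (energies (suc k) 0 w + total w) (n≤0⇒n≡0 l′)))
  go (suc n) l′ with runners-surjective′ n w (s≤s⁻¹ (≤-trans (m<m+n _ (n≢0⇒n>0 t≢0)) l′))
  ... | []    , p = ⊥-elim (t≢0 (trans (cong total (sym p)) (total-runners {k} [])))
  ... | x ∷ d , p = suc x ∷ d , cong (rot inc) p

runners-surjective : ∀ {k} (v : Vec (List ℕ) (suc k)) → ∃ λ d → runners d ≡ v
runners-surjective v = runners-surjective′ _ v ≤-refl

-- Partitions as lists of gaps

∸-suc : ∀ {s n} → s < n → n ∸ s ≡ suc (n ∸ suc s)
∸-suc l = +-∸-assoc 1 l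

-- Diagrams are handled as row functions: empty rows cost nothing and single rows can be altered.
-- `toPartition` leads back to lists.
Antitone : (ℕ → ℕ) → Set
Antitone f = ∀ s → f (suc s) ≤ f s

antitone-+ : ∀ {f} → Antitone f → ∀ s t → f (s + t) ≤ f s
antitone-+ {f} a s zero    = ≤-reflexive (cong f (+-identityʳ s))
antitone-+ {f} a s (suc t) = ≤-trans (≤-reflexive (cong f (+-suc s t))) (≤-trans (a (s + t)) (antitone-+ a s t))

antitone-≤ : ∀ {f} → Antitone f → ∀ {s t} → s ≤ t → f t ≤ f s
antitone-≤ {f} a {s} l = subst (λ z → f z ≤ f s) (m+[n∸m]≡n l) (antitone-+ a s _)

part-antitone : ∀ {μ} → Linked _≥_ μ → Antitone (part μ)
part-antitone []      s       = z≤n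
part-antitone [-]     s       = z≤n
part-antitone (g ∷ l) zero    = g
part-antitone (g ∷ l) (suc s) = part-antitone l s

part-[]-length : ∀ μ {s} → length μ ≤ s → part μ s ≡ 0
part-[]-length []      l       = refl
part-[]-length (x ∷ μ) (s≤s l) = part-[]-length μ l

part-injective : ∀ {μ ν} → IsPartition μ → IsPartition ν → (∀ s → part μ s ≡ part ν s) → μ ≡ ν
part-injective {[]}    {[]}    p q e = refl
part-injective {[]}    {y ∷ ν} p (0<y ∷ _ , _) e = ⊥-elim (<⇒≢ 0<y (e 0))
part-injective {x ∷ μ} {[]}    (0<x ∷ _ , _) q e = ⊥-elim (<⇒≢ 0<x (sym (e 0)))
part-injective {x ∷ μ} {y ∷ ν} (_ ∷ p , l) (_ ∷ q , l′) e =
  cong₂ _∷_ (e 0) (part-injective (p , Linked.tail l) (q , Linked.tail l′) (λ s → e (suc s)))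

toPartition : ∀ B f → Antitone f → f B ≡ 0 → ∃ λ μ → IsPartition μ × (∀ s → part μ s ≡ f s)
toPartition B f a e with f 0 in f0
toPartition B f a e | zero = [] , ([] , []) , λ s → sym (n≤0⇒n≡0 (≤-trans (antitone-≤ a z≤n) (≤-reflexive f0)))
toPartition zero f a e | suc x = ⊥-elim (1+n≢0 (trans (sym f0) e))
toPartition (suc B) f a e | suc x with toPartition B (f ∘ suc) (a ∘ suc) e
... | μ , (p , l) , q = suc x ∷ μ , (z<s ∷ p , linked μ l (q 0)) , λ { zero → sym f0 ; (suc s) → q s }
  where
  linked : ∀ μ → Linked _≥_ μ → part μ 0 ≡ f 1 → Linked _≥_ (suc x ∷ μ)
  linked []      l q = [-]
  linked (y ∷ μ) l q = ≤-trans (≤-reflexive q) (≤-trans (a 0) (≤-reflexive f0)) ∷ l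

sumBelow : ℕ → (ℕ → ℕ) → ℕ
sumBelow zero    f = 0
sumBelow (suc n) f = sumBelow n f + f n

sumBelow-cong : ∀ n {f g} → (∀ s → s < n → f s ≡ g s) → sumBelow n f ≡ sumBelow n g
sumBelow-cong zero    e = refl
sumBelow-cong (suc n) e = cong₂ _+_ (sumBelow-cong n (λ s l → e s (m≤n⇒m≤1+n l))) (e n ≤-refl)

sumBelow-suc : ∀ n f → sumBelow (suc n) f ≡ f 0 + sumBelow n (f ∘ suc)
sumBelow-suc zero    f = sym (+-identityʳ (f 0))
sumBelow-suc (suc n) f = trans (cong (_+ f (suc n)) (sumBelow-suc n f)) (+-assoc (f 0) _ _)

sumBelow-0 : ∀ n → sumBelow n (λ _ → 0) ≡ 0
sumBelow-0 zero    = refl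
sumBelow-0 (suc n) = trans (+-identityʳ _) (sumBelow-0 n)

sumBelow-part : ∀ B {μ} → IsPartition μ → part μ B ≡ 0 → sumBelow B (part μ) ≡ size μ
sumBelow-part B {[]} p e = sumBelow-0 B
sumBelow-part zero {x ∷ μ} (0<x ∷ _ , _) e = ⊥-elim (<⇒≢ 0<x (sym e))
sumBelow-part (suc B) {x ∷ μ} (_ ∷ p , l) e =
  trans (sumBelow-suc B (part (x ∷ μ))) (cong (x +_) (sumBelow-part B (p , Linked.tail l) e))

-- The bottom row comes first, in agreement with the lowest bead first in `runners`.
diffs : ℕ → (ℕ → ℕ) → List ℕ
diffs zero    f = []
diffs (suc B) f = f B ∸ f (suc B) ∷ diffs B f

length-diffs : ∀ B f → length (diffs B f) ≡ B
length-diffs zero    f = refl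
length-diffs (suc B) f = cong suc (length-diffs B f)

diffs-cong : ∀ B {f g} → (∀ s → s < B → f s ∸ f (suc s) ≡ g s ∸ g (suc s)) → diffs B f ≡ diffs B g
diffs-cong zero    e = refl
diffs-cong (suc B) e = cong₂ _∷_ (e B ≤-refl) (diffs-cong B (λ s l → e s (m≤n⇒m≤1+n l)))

-- Summation by parts. The boundary term `B * f B` is kept because the induction passes through rows
-- that are not empty.
gapSize-diffs : ∀ B {f} → Antitone f → gapSize (diffs B f) + B * f B ≡ sumBelow B f
gapSize-diffs zero a = refl
gapSize-diffs (suc B) {f} a = begin
  (f B ∸ f (suc B)) * suc (length (diffs B f)) + gapSize (diffs B f) + suc B * f (suc B)
    ≡⟨ cong (λ z → (f B ∸ f (suc B)) * suc z + gapSize (diffs B f) + suc B * f (suc B)) (length-diffs B f) ⟩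
  (f B ∸ f (suc B)) * suc B + gapSize (diffs B f) + suc B * f (suc B)
    ≡⟨ lem₁ (f B ∸ f (suc B)) B (gapSize (diffs B f)) (f (suc B)) ⟩
  gapSize (diffs B f) + suc B * (f B ∸ f (suc B) + f (suc B))
    ≡⟨ cong (λ z → gapSize (diffs B f) + suc B * z) (m∸n+n≡m (a B)) ⟩
  gapSize (diffs B f) + suc B * f B
    ≡⟨ lem₂ (gapSize (diffs B f)) B (f B) ⟩
  gapSize (diffs B f) + B * f B + f B
    ≡⟨ cong (_+ f B) (gapSize-diffs B a) ⟩
  sumBelow B f + f B ∎
  where
  open ≡-Reasoning
  lem₁ : ∀ x b s y → x * suc b + s + suc b * y ≡ s + suc b * (x + y)
  lem₁ = solve-∀
  lem₂ : ∀ s b x → s + suc b * x ≡ s + b * x + x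
  lem₂ = solve-∀

gapSize-part : ∀ B {μ} → IsPartition μ → part μ B ≡ 0 → gapSize (diffs B (part μ)) ≡ size μ
gapSize-part B {μ} p e = trans (sym (trans (cong (λ z → gapSize (diffs B (part μ)) + B * z) e)
    (trans (cong (gapSize (diffs B (part μ)) +_) (*-zeroʳ B)) (+-identityʳ _))))
  (trans (gapSize-diffs B (part-antitone (proj₂ p))) (sumBelow-part B p e))

-- Inverse to `diffs`: the head of `x ∷ d` is the gap of row `length d`, so it contributes to that
-- row and to all rows above it.
partOf : List ℕ → ℕ → ℕ
partOf []      s = 0
partOf (x ∷ d) s with s ≤? length d
... | yes _ = x + partOf d s
... | no  _ = 0

partOf-≤ : ∀ x d {s} → s ≤ length d → partOf (x ∷ d) s ≡ x + partOf d s
partOf-≤ x d {s} l with s ≤? length d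
... | yes _ = refl
... | no ¬l = ⊥-elim (¬l l)

partOf-≥ : ∀ d {s} → length d ≤ s → partOf d s ≡ 0
partOf-≥ []      l = refl
partOf-≥ (x ∷ d) {s} l with s ≤? length d
... | yes l′ = ⊥-elim (<⇒≱ l l′)
... | no  _  = refl

partOf-antitone : ∀ d → Antitone (partOf d)
partOf-antitone []      s = z≤n
partOf-antitone (x ∷ d) s with suc s ≤? length d
... | no _  = z≤n
... | yes l = ≤-trans (+-monoʳ-≤ x (partOf-antitone d s)) (≤-reflexive (sym (partOf-≤ x d (≤-trans (n≤1+n s) l))))

diffs-partOf : ∀ d → diffs (length d) (partOf d) ≡ d
diffs-partOf [] = refl
diffs-partOf (x ∷ d) = cong₂ _∷_
  (trans (cong₂ _∸_ (trans (partOf-≤ x d ≤-refl) (trans (cong (x +_) (partOf-≥ d ≤-refl)) (+-identityʳ x)))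
                    (partOf-≥ (x ∷ d) ≤-refl)) refl)
  (trans (diffs-cong (length d) (λ s l → trans (cong₂ _∸_ (partOf-≤ x d (<⇒≤ l)) (partOf-≤ x d l)) ([m+n]∸[m+o]≡n∸o x _ _)))
    (diffs-partOf d))

partOf-diffs : ∀ B {f} → Antitone f → ∀ {s} → s ≤ B → partOf (diffs B f) s + f B ≡ f s
partOf-diffs zero a z≤n = refl
partOf-diffs (suc B) {f} a {s} l with m≤n⇒m<n∨m≡n l
... | inj₂ refl = cong (_+ f (suc B)) (partOf-≥ (diffs (suc B) f) (≤-reflexive (length-diffs (suc B) f)))
... | inj₁ (s≤s l′) = begin
  partOf (diffs (suc B) f) s + f (suc B)
    ≡⟨ cong (_+ f (suc B)) (partOf-≤ (f B ∸ f (suc B)) (diffs B f) (≤-trans l′ (≤-reflexive (sym (length-diffs B f))))) ⟩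
  f B ∸ f (suc B) + partOf (diffs B f) s + f (suc B)
    ≡⟨ lem (f B ∸ f (suc B)) (partOf (diffs B f) s) (f (suc B)) ⟩
  partOf (diffs B f) s + (f B ∸ f (suc B) + f (suc B))
    ≡⟨ cong (partOf (diffs B f) s +_) (m∸n+n≡m (a B)) ⟩
  partOf (diffs B f) s + f B
    ≡⟨ partOf-diffs B a l′ ⟩
  f s ∎
  where
  open ≡-Reasoning
  lem : ∀ a b c → a + b + c ≡ b + (a + c)
  lem = solve-∀

partOf-diffs-0 : ∀ B {f} → Antitone f → f B ≡ 0 → ∀ s → partOf (diffs B f) s ≡ f s
partOf-diffs-0 B {f} a e s with s ≤? B
... | yes l = trans (sym (+-identityʳ _)) (trans (cong (partOf (diffs B f) s +_) (sym e)) (partOf-diffs B a l))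
... | no ¬l = trans (partOf-≥ (diffs B f) (≤-trans (≤-reflexive (length-diffs B f)) (<⇒≤ (≰⇒> ¬l))))
                (sym (n≤0⇒n≡0 (≤-trans (antitone-≤ a (<⇒≤ (≰⇒> ¬l))) (≤-reflexive e))))

-- The charge as a count of bead positions by residue

zipWith-∷ʳ : ∀ {A B C : Set} {n} (f : A → B → C) (xs : Vec A n) (ys : Vec B n) x y →
  zipWith f (xs ∷ʳ x) (ys ∷ʳ y) ≡ zipWith f xs ys ∷ʳ f x y
zipWith-∷ʳ f []       []       x y = refl
zipWith-∷ʳ f (a ∷ xs) (b ∷ ys) x y = cong (f a b ∷_) (zipWith-∷ʳ f xs ys x y)

rot-zipWith : ∀ {k} (v w : Vec ℕ (suc k)) → rot id (zipWith _+_ v w) ≡ zipWith _+_ (rot id v) (rot id w)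
rot-zipWith = snoc-elim _ λ xs x → snoc-elim _ λ ys y →
  trans (cong (rot id) (zipWith-∷ʳ _+_ xs ys x y)) (trans (rot-∷ʳ id (zipWith _+_ xs ys) (x + y))
    (sym (cong₂ (zipWith _+_) (rot-∷ʳ id xs x) (rot-∷ʳ id ys y))))

rotN-zipWith : ∀ {k} n (v w : Vec ℕ (suc k)) → rotN id n (zipWith _+_ v w) ≡ zipWith _+_ (rotN id n v) (rotN id n w)
rotN-zipWith zero    v w = refl
rotN-zipWith (suc n) v w = trans (cong (rot id) (rotN-zipWith n v w)) (rot-zipWith _ _)

e₀ : ∀ k → Vec ℕ (suc k)
e₀ k = 1 ∷ replicate k 0

-- Splits off the contribution of one bead, so that the recursion for the charge unfolds into a sum
-- of rotated unit vectors.
rot-suc : ∀ {k} (v : Vec ℕ (suc k)) → rot suc v ≡ zipWith _+_ (e₀ k) (rot id v)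
rot-suc v = cong (suc (last v) ∷_) (sym (Vec.zipWith-identityˡ +-identityˡ (init v)))

-- The indicator of p ≡ i modulo m, in a form that meets the rotations in `charge-∷`; only its
-- periodicity is needed later.
onRunner : ∀ {k} → Fin (suc k) → ℕ → ℕ
onRunner {k} i p = lookup (rotN id p (e₀ k)) i

onRunner-period : ∀ {k} (i : Fin (suc k)) p → onRunner i (p + suc k) ≡ onRunner i p
onRunner-period {k} i p = cong (λ v → lookup v i) (trans (rotN-+ id p (suc k) _) (cong (rotN id p) (rotN-period _)))

rotN-0 : ∀ {k} n → rotN id n (replicate (suc k) 0) ≡ replicate (suc k) 0
rotN-0 zero = refl
rotN-0 {k} (suc n) = trans (cong (rot id) (rotN-0 n)) (rot-0 k)
  where
  replicate-∷ʳ : ∀ k → replicate (suc k) 0 ≡ replicate k 0 ∷ʳ 0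
  replicate-∷ʳ zero    = refl
  replicate-∷ʳ (suc k) = cong (0 ∷_) (replicate-∷ʳ k)
  rot-0 : ∀ k → rot id (replicate (suc k) 0) ≡ replicate (suc k) 0
  rot-0 k = trans (cong (rot id) (replicate-∷ʳ k)) (rot-∷ʳ id _ 0)

-- The beta-number of row `s`, that is, the position of its bead.
bead : List ℕ → ℕ → ℕ
bead d s = partOf d s + (length d ∸ suc s)

-- The charge counts the beads by residue modulo m, which a rim hook removal preserves.
charge-beads : ∀ {k} y d (i : Fin (suc k)) →
  lookup (rotN id y (charge k d)) i ≡ sumBelow (length d) (λ s → onRunner i (y + bead d s))
charge-beads {k} y [] i = trans (cong (λ v → lookup (rotN id y v) i) (Vec.map-replicate length [] (suc k)))
  (trans (cong (λ v → lookup v i) (rotN-0 y)) (Vec.lookup-replicate i 0))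
charge-beads {k} y (x ∷ d) i = begin
  lookup (rotN id y (charge k (x ∷ d))) i
    ≡⟨ cong (λ v → lookup v i) (trans (cong (rotN id y) (charge-∷ x d)) (sym (rotN-+ id y x _))) ⟩
  lookup (rotN id (y + x) (rot suc (charge k d))) i
    ≡⟨ cong (λ v → lookup v i) (trans (cong (rotN id (y + x)) (rot-suc (charge k d))) (rotN-zipWith (y + x) (e₀ k) (rot id (charge k d)))) ⟩
  lookup (zipWith _+_ (rotN id (y + x) (e₀ k)) (rotN id (y + x) (rot id (charge k d)))) i
    ≡⟨ Vec.lookup-zipWith _+_ i (rotN id (y + x) (e₀ k)) _ ⟩
  onRunner i (y + x) + lookup (rotN id (y + x) (rot id (charge k d))) i
    ≡⟨ cong (λ v → onRunner i (y + x) + lookup v i) (sym (rotN-+ id (y + x) 1 (charge k d))) ⟩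
  onRunner i (y + x) + lookup (rotN id (y + x + 1) (charge k d)) i
    -- The offset `y` is general because the first gap and its bead displace all later beads by
    -- `x + 1`.
    ≡⟨ cong (onRunner i (y + x) +_) (charge-beads (y + x + 1) d i) ⟩
  onRunner i (y + x) + sumBelow (length d) (λ s → onRunner i (y + x + 1 + bead d s))
    ≡⟨ cong₂ _+_ (cong (onRunner i) (sym low)) (sumBelow-cong (length d) (λ s l → cong (onRunner i) (high s l))) ⟩
  onRunner i (y + bead (x ∷ d) (length d)) + sumBelow (length d) (λ s → onRunner i (y + bead (x ∷ d) s))
    ≡⟨ +-comm (onRunner i (y + bead (x ∷ d) (length d))) _ ⟩
  sumBelow (length d) (λ s → onRunner i (y + bead (x ∷ d) s)) + onRunner i (y + bead (x ∷ d) (length d)) ∎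
  where
  open ≡-Reasoning
  low : y + bead (x ∷ d) (length d) ≡ y + x
  low = cong (y +_) (trans (cong₂ _+_ (trans (partOf-≤ x d ≤-refl) (cong (x +_) (partOf-≥ d ≤-refl))) (n∸n≡0 (length d)))
    (trans (+-identityʳ _) (+-identityʳ x)))
  lem : ∀ y x p q → y + x + 1 + (p + q) ≡ y + (x + p + suc q)
  lem = solve-∀
  high : ∀ s → s < length d → y + x + 1 + bead d s ≡ y + bead (x ∷ d) s
  high s l = trans (lem y x (partOf d s) (length d ∸ suc s))
    (cong (y +_) (cong₂ _+_ (sym (partOf-≤ x d (<⇒≤ l))) (sym (∸-suc l))))

-- Rim hooks preserve the charge

lookup-injective : ∀ {A : Set} {n} (v w : Vec A n) → (∀ i → lookup v i ≡ lookup w i) → v ≡ w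
lookup-injective v w e = trans (sym (Vec.tabulate∘lookup v)) (trans (Vec.tabulate-cong e) (Vec.tabulate∘lookup w))

-- f and g are the rows of two diagrams differing by a rim hook of size m with rows r , … , r + u.
record RimHook (m : ℕ) (f g : ℕ → ℕ) : Set where
  field
    r u   : ℕ
    above : ∀ s → s < r → f s ≡ g s
    along : ∀ v → v < u → f (suc (r + v)) ≡ suc (g (r + v))
    end   : g (r + u) < f (r + u)
    below : ∀ s → r + u < s → f s ≡ g s
    span  : f r + u ≡ g (r + u) + m

module _ (r δ : ℕ) {a b : ℕ → ℕ} (above : ∀ s → s < r → a s ≡ b s) where

  telescope : ∀ u → (∀ v → v < u → a (suc (r + v)) ≡ b (r + v) + δ) →
    sumBelow (suc (r + u)) a ≡ sumBelow (r + u) b + (a r + u * δ)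
  telescope zero along = trans (cong (λ z → sumBelow z a + a z) (+-identityʳ r))
    (cong₂ _+_ (trans (sumBelow-cong r above) (cong (λ z → sumBelow z b) (sym (+-identityʳ r)))) (sym (+-identityʳ (a r))))
  telescope (suc u) along = begin
    sumBelow (suc (r + suc u)) a
      ≡⟨ cong (λ z → sumBelow (suc z) a) (+-suc r u) ⟩
    sumBelow (suc (r + u)) a + a (suc (r + u))
      ≡⟨ cong₂ _+_ (telescope u (λ v l → along v (m≤n⇒m≤1+n l))) (along u ≤-refl) ⟩
    sumBelow (r + u) b + (a r + u * δ) + (b (r + u) + δ)
      ≡⟨ lem (sumBelow (r + u) b) (a r) (u * δ) (b (r + u)) δ ⟩
    sumBelow (suc (r + u)) b + (a r + suc u * δ)
      ≡⟨ cong (λ z → sumBelow z b + (a r + suc u * δ)) (sym (+-suc r u)) ⟩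
    sumBelow (r + suc u) b + (a r + suc u * δ) ∎
    where
    open ≡-Reasoning
    lem : ∀ s x w y d → s + (x + w) + (y + d) ≡ s + y + (x + (d + w))
    lem = solve-∀

  -- The shifted rows cancel, leaving `a r` against `b (r + u)`. It is used with δ = 1 on row
  -- lengths, for the sizes, and with δ = 0 on residue indicators, for the charge.
  rows-swap : ∀ u → (∀ v → v < u → a (suc (r + v)) ≡ b (r + v) + δ) → (∀ s → r + u < s → a s ≡ b s) →
    ∀ {B} → r + u < B → sumBelow B a + b (r + u) ≡ sumBelow B b + (a r + u * δ)
  rows-swap u along below {B} l = subst (λ z → sumBelow z a + b (r + u) ≡ sumBelow z b + (a r + u * δ)) (m+[n∸m]≡n l) (go (B ∸ suc (r + u)))
    where
    swap₃ : ∀ x y z → x + y + z ≡ x + z + y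
    swap₃ = solve-∀
    go : ∀ t → sumBelow (suc (r + u) + t) a + b (r + u) ≡ sumBelow (suc (r + u) + t) b + (a r + u * δ)
    go zero = subst (λ z → sumBelow z a + b (r + u) ≡ sumBelow z b + (a r + u * δ)) (sym (+-identityʳ (suc (r + u))))
      (trans (cong (_+ b (r + u)) (telescope u along)) (swap₃ (sumBelow (r + u) b) (a r + u * δ) (b (r + u))))
    go (suc t) = subst (λ z → sumBelow z a + b (r + u) ≡ sumBelow z b + (a r + u * δ)) (sym (+-suc (suc (r + u)) t))
      (trans (swap₃ (sumBelow (suc (r + u) + t) a) (a (suc (r + u) + t)) (b (r + u)))
      (trans (cong₂ _+_ (go t) (below (suc (r + u) + t) (m≤m+n _ t)))
      (swap₃ (sumBelow (suc (r + u) + t) b) (a r + u * δ) (b (suc (r + u) + t)))))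

end<B : ∀ {f g : ℕ → ℕ} {B j} → Antitone f → f B ≡ 0 → g j < f j → j < B
end<B {f} {g} {B} {j} a e l with j <? B
... | yes p = p
... | no ¬p = ⊥-elim (<⇒≱ (≤-<-trans z≤n l) (≤-trans (antitone-≤ a (≮⇒≥ ¬p)) (≤-reflexive e)))

-- In terms of beads, row `r + v + 1` of `f` and row `r + v` of `g` have the same position, and the
-- bead of row `r` of `f` lies exactly m above that of row `r + u` of `g`; hence no residue changes.
RimHook-charge : ∀ {k f g} B → Antitone f → Antitone g → f B ≡ 0 → g B ≡ 0 → RimHook (suc k) f g →
  charge k (diffs B f) ≡ charge k (diffs B g)
RimHook-charge {k} {f} {g} B af ag ef eg h = lookup-injective _ _ λ i →
  trans (beadSum f af ef i) (trans (+-cancelʳ-≡ (b i (r + u)) _ _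
    (trans (rows-swap r 0 {a i} {b i} (λ s l → cong (λ z → onRunner i (z + (B ∸ suc s))) (above s l)) u
        (λ v l → trans (cong (onRunner i) (shift v l)) (sym (+-identityʳ _)))
        (λ s l → cong (λ z → onRunner i (z + (B ∸ suc s))) (below s l)) j<B)
      (cong (sumBelow B (b i) +_) (trans (cong (a i r +_) (*-zeroʳ u)) (trans (+-identityʳ _) (ends i))))))
  (sym (beadSum g ag eg i)))
  where
  open RimHook h
  a b : Fin (suc k) → ℕ → ℕ
  a i s = onRunner i (f s + (B ∸ suc s))
  b i s = onRunner i (g s + (B ∸ suc s))
  j<B : r + u < B
  j<B = end<B {g = g} af ef end
  beadSum : ∀ f → Antitone f → f B ≡ 0 → ∀ i → lookup (charge k (diffs B f)) i ≡ sumBelow B (λ s → onRunner i (f s + (B ∸ suc s)))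
  beadSum f a e i = trans (charge-beads 0 (diffs B f) i) (trans (cong (λ z → sumBelow z (λ s → onRunner i (bead (diffs B f) s))) (length-diffs B f))
    (sumBelow-cong B (λ s l → cong₂ (λ x y → onRunner i (x + (y ∸ suc s))) (partOf-diffs-0 B a e s) (length-diffs B f))))
  shift : ∀ v → v < u → f (suc (r + v)) + (B ∸ suc (suc (r + v))) ≡ g (r + v) + (B ∸ suc (r + v))
  shift v l = trans (cong (_+ (B ∸ suc (suc (r + v)))) (along v l)) (trans (sym (+-suc (g (r + v)) _))
    (cong (g (r + v) +_) (sym (∸-suc (≤-<-trans (≤-trans (≤-reflexive (sym (+-suc r v))) (+-monoʳ-≤ r l)) j<B)))))
  ends : ∀ i → a i r ≡ b i (r + u)
  ends i = trans (cong (onRunner i) eq) (onRunner-period i (g (r + u) + (B ∸ suc (r + u))))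
    where
    lem₁ : ∀ x y z → x + (y + z) ≡ x + y + z
    lem₁ = solve-∀
    lem₂ : ∀ x y z → x + y + z ≡ x + z + y
    lem₂ = solve-∀
    eq : f r + (B ∸ suc r) ≡ g (r + u) + (B ∸ suc (r + u)) + suc k
    eq = trans (cong (λ z → f r + (z ∸ suc r)) (sym (m+[n∸m]≡n j<B)))
      (trans (cong (f r +_) (trans (cong (_∸ suc r) (+-assoc (suc r) u _)) (m+n∸m≡n (suc r) _)))
      (trans (lem₁ (f r) u _) (trans (cong (_+ (B ∸ suc (r + u))) span) (lem₂ (g (r + u)) (suc k) _))))

-- Cores and rim hooks

-- The cell (r , c) with leg u and hook length m.
record HookCell (m : ℕ) (f : ℕ → ℕ) : Set where
  constructor hookCell
  field
    r u c : ℕ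
    inside : c < f (r + u)
    bottom : f (suc (r + u)) ≤ c
    span   : f r + u ≡ c + m

HookCell-resp : ∀ {m f g} → (∀ s → f s ≡ g s) → HookCell m f → HookCell m g
HookCell-resp e (hookCell r u c i b s) = hookCell r u c (≤-trans i (≤-reflexive (e (r + u))))
  (≤-trans (≤-reflexive (sym (e (suc (r + u))))) b) (trans (cong (_+ u) (sym (e r))) s)

lookup-init : ∀ {A : Set} {k} (v : Vec A (suc k)) i → lookup (init v) i ≡ lookup v (inject₁ i)
lookup-init {k = suc k} (x ∷ v) zero    = refl
lookup-init {k = suc k} (x ∷ v) (suc i) = lookup-init v i

lookup-last : ∀ {A : Set} {k} (v : Vec A (suc k)) → lookup v (fromℕ k) ≡ last v
lookup-last {k = zero}  (x ∷ []) = refl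
lookup-last {k = suc k} (x ∷ v)  = lookup-last v

partOf-suc∷ : ∀ x d {s} → s ≤ length d → partOf (suc x ∷ d) s ≡ suc (partOf (x ∷ d) s)
partOf-suc∷ x d l = trans (partOf-≤ (suc x) d l) (cong suc (sym (partOf-≤ x d l)))

partOf-suc∷-≤ : ∀ x d s → partOf (suc x ∷ d) s ≤ suc (partOf (x ∷ d) s)
partOf-suc∷-≤ x d s with s ≤? length d
... | yes _ = ≤-refl
... | no  _ = z≤n

partOf-0∷ : ∀ d s → partOf (0 ∷ d) s ≡ partOf d s
partOf-0∷ d s with s ≤? length d
... | yes _ = refl
... | no ¬l = sym (partOf-≥ d (<⇒≤ (≰⇒> ¬l)))

-- The lowest level of runner i is position i. The equation is `bead d r ≡ toℕ i` with the
-- subtraction cleared.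
position-occupied : ∀ {k} d (i : Fin (suc k)) {t} → lookup (runners d) i ≡ 0 ∷ t →
  ∃ λ r → r < length d × partOf d r + length d ≡ toℕ i + suc r
position-occupied [] i e with () ← trans (sym (Vec.lookup-replicate i [])) e
position-occupied (zero ∷ d) zero e = length d , ≤-refl , cong (_+ suc (length d)) (trans (partOf-0∷ d _) (partOf-≥ d ≤-refl))
position-occupied {suc k} (zero ∷ d) (suc i) e with position-occupied d (inject₁ i) (trans (sym (lookup-init (runners d) i)) e)
... | r , l , q = r , m≤n⇒m≤1+n l , trans (cong (_+ suc (length d)) (partOf-0∷ d r))
  (trans (+-suc _ _) (cong suc (trans q (cong (_+ suc r) (toℕ-inject₁ i)))))
position-occupied (suc x ∷ d) zero e = ⊥-elim (0∷≢inc _ (sym e))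
position-occupied {suc k} (suc x ∷ d) (suc i) e with position-occupied (x ∷ d) (inject₁ i) (trans (sym (lookup-init (runners (x ∷ d)) i)) e)
... | r , l , q = r , l , trans (cong (_+ suc (length d)) (partOf-suc∷ x d (s≤s⁻¹ l)))
  (cong suc (trans q (cong (_+ suc r) (toℕ-inject₁ i))))

zeros : ℕ → List ℕ
zeros n = List.replicate n 0

flatten : ∀ {n} → Vec ℕ n → Vec (List ℕ) n
flatten = Vec.map zeros

-- The beads of each runner are pushed down as far as possible: the abacus of a core, visibly
-- determined by its charge.
Flat : ∀ {n} → Vec (List ℕ) n → Set
Flat v = v ≡ flatten (Vec.map length v)

HookCell-suc∷ : ∀ {m x d} → HookCell m (partOf (x ∷ d)) → HookCell m (partOf (suc x ∷ d))
HookCell-suc∷ {m} {x} {d} (hookCell r u c i b s) = hookCell r u (suc c)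
  (≤-trans (s≤s i) (≤-reflexive (sym (partOf-suc∷ x d l)))) (≤-trans (partOf-suc∷-≤ x d (suc (r + u))) (s≤s b))
  (trans (cong (_+ u) (partOf-suc∷ x d (≤-trans (m≤m+n r u) l))) (cong suc s))
  where
  l : r + u ≤ length d
  l = ≮⇒≥ λ l′ → <⇒≱ (≤-<-trans z≤n i) (≤-reflexive (partOf-≥ (x ∷ d) l′))

-- Hooks persist while the configuration is built up, and inserting a bead at position 0 keeps it
-- flat. Flatness fails only when a shift lifts a nonempty last runner: position m becomes occupied
-- above the empty position 0.
flat-or-hook : ∀ {k} d → Flat (runners {k} d) ⊎ HookCell (suc k) (partOf d)
flat-or-hook {k} [] = inj₁ (sym (trans (cong flatten (Vec.map-replicate length [] (suc k))) (Vec.map-replicate zeros 0 (suc k))))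
flat-or-hook {k} (zero ∷ d) with flat-or-hook {k} d
... | inj₂ h = inj₂ (HookCell-resp (λ s → sym (partOf-0∷ d s)) h)
... | inj₁ p = inj₁ (trans (cong (rot (0 ∷_)) p) (sym (trans (cong flatten (charge-0∷ d)) (map-rot zeros suc (0 ∷_) (λ _ → refl) (charge k d)))))
flat-or-hook {k} (suc x ∷ d) with flat-or-hook {k} (x ∷ d)
... | inj₂ h = inj₂ (HookCell-suc∷ h)
... | inj₁ p = go (initLast (runners (x ∷ d))) refl
  where
  go : (z : ∃ λ (δs : Vec (List ℕ) k) → ∃ λ δ → runners (x ∷ d) ≡ δs ∷ʳ δ) → initLast (runners (x ∷ d)) ≡ z →
    Flat (runners {k} (suc x ∷ d)) ⊎ HookCell (suc k) (partOf (suc x ∷ d))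
  go (δs , [] , e) _ = inj₁ (subst Flat (sym e′) (cong ([] ∷_) flat-init))
    where
    e′ : runners {k} (suc x ∷ d) ≡ [] ∷ δs
    e′ = trans (cong (rot inc) e) (rot-∷ʳ inc δs [])
    flat-init : δs ≡ flatten (Vec.map length δs)
    flat-init = Vec.∷ʳ-injectiveˡ δs _ (trans (sym e) (trans p (trans (cong (λ v → flatten (Vec.map length v)) e)
      (trans (cong flatten (Vec.map-∷ʳ length [] δs)) (Vec.map-∷ʳ zeros 0 (Vec.map length δs))))))
  -- By flatness the last runner has a bead at its lowest level, which is position k before the
  -- shift and m after it.
  go (δs , y ∷ δ , e) _ = inj₂ (found (position-occupied (x ∷ d) (fromℕ k) {δ} (trans (lookup-last (runners (x ∷ d)))
      (trans (cong last e) (trans (Vec.last-∷ʳ (y ∷ δ) δs) (cong (_∷ δ) y≡0))))))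
    where
    y≡0 : y ≡ 0
    y≡0 = List.∷-injectiveˡ (Vec.∷ʳ-injectiveʳ δs _ (trans (sym e) (trans p (trans (cong (λ v → flatten (Vec.map length v)) e)
      (trans (cong flatten (Vec.map-∷ʳ length (y ∷ δ) δs)) (Vec.map-∷ʳ zeros (suc (length δ)) (Vec.map length δs)))))))
    found : (∃ λ r → r < suc (length d) × partOf (x ∷ d) r + suc (length d) ≡ toℕ (fromℕ k) + suc r) → HookCell (suc k) (partOf (suc x ∷ d))
    -- Moving this bead to position 0 puts it below all others, so the hook starts in column 0 and
    -- reaches the bottom row `length d`.
    found (r , l , q) = hookCell r u 0
      (≤-trans (s≤s z≤n) (≤-reflexive (sym (partOf-suc∷ x d (≤-reflexive r+u)))))
      (≤-reflexive (partOf-≥ (suc x ∷ d) (s≤s (≤-reflexive (sym r+u)))))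
      (trans (cong (_+ u) (partOf-suc∷ x d (s≤s⁻¹ l))) (cong suc (+-cancelʳ-≡ (suc r) _ _
        (trans (lem (partOf (x ∷ d) r) u r) (trans (cong (λ z → partOf (x ∷ d) r + suc z) r+u) (trans q (cong (_+ suc r) (toℕ-fromℕ k))))))))
      where
      u : ℕ
      u = length d ∸ r
      r+u : r + u ≡ length d
      r+u = m+[n∸m]≡n (s≤s⁻¹ l)
      lem : ∀ p u r → p + u + suc r ≡ p + suc (r + u)
      lem = solve-∀

data Zone (r u : ℕ) : ℕ → Set where
  zone-above : ∀ {s} → s < r → Zone r u s
  zone-along : ∀ v → v < u → Zone r u (r + v)
  zone-end   : Zone r u (r + u)
  zone-below : ∀ {s} → r + u < s → Zone r u s

zone : ∀ r u s → Zone r u s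
zone r u s with s <? r
... | yes l = zone-above l
... | no ¬l with <-cmp s (r + u)
...   | tri< l _ _ = subst (Zone r u) (m+[n∸m]≡n (≮⇒≥ ¬l)) (zone-along (s ∸ r)
          (+-cancelˡ-< r _ _ (≤-trans (≤-reflexive (cong suc (m+[n∸m]≡n (≮⇒≥ ¬l)))) l)))
...   | tri≈ _ refl _ = zone-end
...   | tri> _ _ g = zone-below g

-- The rows that remain after removing the rim hook with rows r , … , r + u that ends in column c.
cut : (ℕ → ℕ) → ∀ {r u} → ℕ → ∀ {s} → Zone r u s → ℕ
cut f c {s} (zone-above _)   = f s
cut f {r} c (zone-along v _) = pred (f (suc (r + v)))
cut f c     zone-end         = c
cut f c {s} (zone-below _)   = f s

module _ {m : ℕ} {f g : ℕ → ℕ} (af : Antitone f) (h : RimHook m f g) where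

  open RimHook h using (r; u)

  rimHook-< : ∀ v → v ≤ u → g (r + v) < f (r + v)
  rimHook-< v l with m≤n⇒m<n∨m≡n l
  ... | inj₁ l′   = ≤-trans (≤-reflexive (sym (RimHook.along h v l′))) (af (r + v))
  ... | inj₂ refl = RimHook.end h

  rimHook-≤ : ∀ s → g s ≤ f s
  rimHook-≤ s with zone r u s
  ... | zone-above l   = ≤-reflexive (sym (RimHook.above h s l))
  ... | zone-along v l = <⇒≤ (rimHook-< v (<⇒≤ l))
  ... | zone-end       = <⇒≤ (rimHook-< u ≤-refl)
  ... | zone-below l   = ≤-reflexive (sym (RimHook.below h s l))

  rimHook-antitone : f (suc (r + u)) ≤ g (r + u) → Antitone g
  rimHook-antitone b s with zone r u s
  ... | zone-above l   = ≤-trans (rimHook-≤ (suc s)) (≤-trans (af s) (≤-reflexive (RimHook.above h s l)))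
  ... | zone-along v l = s≤s⁻¹ (≤-trans (subst (λ z → g z < f z) (+-suc r v) (rimHook-< (suc v) l)) (≤-reflexive (RimHook.along h v l)))
  ... | zone-end       = ≤-trans (rimHook-≤ (suc (r + u))) b
  ... | zone-below l   = ≤-trans (≤-reflexive (sym (RimHook.below h (suc s) (m≤n⇒m≤1+n l)))) (≤-trans (af s) (≤-reflexive (RimHook.below h s l)))

-- The classical correspondence: the hook of a cell has as many cells as the stretch of rim from the
-- end of its row to the foot of its column.
HookCell⇒RimHook : ∀ {m f} → Antitone f → HookCell m f → ∃ λ g → RimHook m f g × Antitone g × (∀ s → g s ≤ f s)
HookCell⇒RimHook {m} {f} af (hookCell r u c i b s) = g , rh , rimHook-antitone af rh (≤-trans b (≤-reflexive (sym (cutEnd (zone r u (r + u)) refl)))) , rimHook-≤ af rh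
  where
  g : ℕ → ℕ
  g s = cut f c (zone r u s)
  r+-≢ : ∀ {v} → v < u → r + v ≢ r + u
  r+-≢ l e = <⇒≢ l (+-cancelˡ-≡ r _ _ e)
  -- These facts are stated for every `z`, since `zone r u s` does not compute on open arguments;
  -- zones that contradict the hypothesis are refuted.
  cutAbove : ∀ {s} (z : Zone r u s) → s < r → f s ≡ cut f c z
  cutAbove (zone-above _)   l = refl
  cutAbove (zone-along v _) l = ⊥-elim (<⇒≱ l (m≤m+n r v))
  cutAbove zone-end         l = ⊥-elim (<⇒≱ l (m≤m+n r u))
  cutAbove (zone-below _)   l = refl
  cutAlong : ∀ {s v} (z : Zone r u s) → s ≡ r + v → v < u → f (suc (r + v)) ≡ suc (cut f c z)
  cutAlong {v = v} (zone-above l) refl _ = ⊥-elim (<⇒≱ l (m≤m+n r v))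
  -- `pred` is undone by `suc` because row `r + v + 1` is not empty: it is at least as long as row
  -- `r + u`, which contains column `c`.
  cutAlong {v = v} (zone-along v′ _) e l rewrite +-cancelˡ-≡ r _ _ e = sym (suc-pred _ {{>-nonZero
    (≤-<-trans z≤n (≤-trans i (antitone-≤ af (≤-trans (≤-reflexive (sym (+-suc r v))) (+-monoʳ-≤ r l)))))}})
  cutAlong zone-end e l = ⊥-elim (r+-≢ l (sym e))
  cutAlong (zone-below l′) refl l = ⊥-elim (<⇒≱ l′ (+-monoʳ-≤ r (<⇒≤ l)))
  cutEnd : ∀ {s} (z : Zone r u s) → s ≡ r + u → cut f c z ≡ c
  cutEnd (zone-above l) refl = ⊥-elim (<⇒≱ l (m≤m+n r u))
  cutEnd (zone-along v l) e = ⊥-elim (r+-≢ l e)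
  cutEnd zone-end e = refl
  cutEnd (zone-below l) refl = ⊥-elim (<-irrefl refl l)
  cutBelow : ∀ {s} (z : Zone r u s) → r + u < s → f s ≡ cut f c z
  cutBelow (zone-above _)   l = refl
  cutBelow (zone-along v l′) l = ⊥-elim (<⇒≱ l (+-monoʳ-≤ r (<⇒≤ l′)))
  cutBelow zone-end         l = ⊥-elim (<-irrefl refl l)
  cutBelow (zone-below _)   l = refl
  rh : RimHook m f g
  rh = record
    { r = r ; u = u
    ; above = λ s → cutAbove (zone r u s)
    ; along = λ v → cutAlong (zone r u (r + v)) refl
    ; end   = ≤-trans (s≤s (≤-reflexive (cutEnd (zone r u (r + u)) refl))) i
    ; below = λ s → cutBelow (zone r u s)
    ; span  = trans s (cong (_+ m) (sym (cutEnd (zone r u (r + u)) refl)))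
    }

RimHook-resp : ∀ {m f g g′} → (∀ s → g′ s ≡ g s) → RimHook m f g → RimHook m f g′
RimHook-resp e h = record
  { r = r ; u = u
  ; above = λ s l → trans (above s l) (sym (e s))
  ; along = λ v l → trans (along v l) (cong suc (sym (e (r + v))))
  ; end   = ≤-trans (s≤s (≤-reflexive (e (r + u)))) end
  ; below = λ s l → trans (below s l) (sym (e s))
  ; span  = trans span (cong (_+ _) (sym (e (r + u))))
  }
  where open RimHook h

-- Rim hooks as connected skew shapes

Path-trans : ∀ {S p q s} → Path S p q → Path S q s → Path S p s
Path-trans (here _)     w = w
Path-trans (step a b v) w = step a b (Path-trans v w)

Adj-sym : ∀ {p q} → Adj p q → Adj q p
Adj-sym right = left
Adj-sym left  = right
Adj-sym down  = up
Adj-sym up    = down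

Path-start : ∀ {S p q} → Path S p q → S p
Path-start (here a)     = a
Path-start (step a _ _) = a

Path-sym : ∀ {S p q} → Path S p q → Path S q p
Path-sym (here a)     = here a
Path-sym (step a b v) = Path-trans (Path-sym v) (step (Path-start v) (Adj-sym b) (here a))

-- Every cell is joined to the lower left `corner`, which gives connectedness. Consecutive rows
-- share only one column, so there is no 2 by 2 square.
RimHook⇒Remove : ∀ {m μ ν B} → IsPartition μ → IsPartition ν → part μ B ≡ 0 → part ν B ≡ 0 →
  RimHook m (part μ) (part ν) → RemoveRimHook m μ ν
RimHook⇒Remove {m} {μ} {ν} {B} pμ pν eμ eν h = pν , rimHook-≤ af h , sizes , connected , no2×2
  where
  open RimHook h renaming (above to above-eq; along to along-eq; end to end-<; below to below-eq)
  af : Antitone (part μ)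
  af = part-antitone (proj₂ pμ)
  S : Cell → Set
  S = InSkew μ ν
  sizes : size μ ≡ size ν + m
  sizes = +-cancelʳ-≡ (part ν (r + u)) _ _ (trans (cong (_+ part ν (r + u)) (sym (sumBelow-part B pμ eμ)))
    (trans (rows-swap r 1 {part μ} {part ν} above-eq u (λ v l → trans (along-eq v l) (+-comm 1 _)) below-eq (end<B {g = part ν} af eμ end-<))
    (trans (cong₂ (λ x y → x + (part μ r + y)) (sumBelow-part B pν eν) (*-identityʳ u))
    (trans (cong (size ν +_) (trans span (+-comm _ m))) (sym (+-assoc (size ν) m _))))))
  leftwards : ∀ s t → S (s , part ν s + t) → Path S (s , part ν s + t) (s , part ν s)
  leftwards s zero    p = subst (λ z → Path S (s , z) (s , part ν s)) (sym (+-identityʳ _)) (here (subst (λ z → S (s , z)) (+-identityʳ _) p))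
  leftwards s (suc t) p = subst (λ z → S (s , z) → Path S (s , z) (s , part ν s)) (sym (+-suc (part ν s) t))
    (λ p′ → step p′ left (leftwards s t (<-trans ≤-refl (proj₁ p′) , m≤m+n (part ν s) t))) p
  corner : Cell
  corner = r + u , part ν (r + u)
  to-corner : ∀ w v → v + w ≡ u → ∀ c → S (r + v , c) → Path S (r + v , c) corner
  to-corner zero v e c p = subst (λ z → S (r + z , c) → Path S (r + z , c) corner) (trans (sym e) (+-identityʳ v))
    (λ p′ → subst (λ z → S (r + u , z) → Path S (r + u , z) corner) (m+[n∸m]≡n (proj₂ p′)) (leftwards (r + u) _) p′) p
  to-corner (suc w) v e c p = Path-trans
    (subst (λ z → S (r + v , z) → Path S (r + v , z) (r + v , part ν (r + v))) (m+[n∸m]≡n (proj₂ p)) (leftwards (r + v) _) p)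
    -- By `along-eq`, the first cell of this row stands directly above the last cell of the next
    -- one.
    (step (rimHook-< af h v (<⇒≤ v<u) , ≤-refl) down
      (subst (λ z → Path S (z , part ν (r + v)) corner) (+-suc r v)
        (to-corner w (suc v) (trans (sym (+-suc v w)) e) (part ν (r + v))
          (subst (λ z → S (z , part ν (r + v))) (sym (+-suc r v))
            (≤-reflexive (sym (along-eq v v<u)) , part-antitone (proj₂ pν) (r + v))))))
    where
    v<u : v < u
    v<u = ≤-trans (m≤m+n (suc v) w) (≤-reflexive (trans (sym (+-suc v w)) e))
  cell-to-corner : ∀ p → S p → Path S p corner
  cell-to-corner (s , c) p with zone r u s
  ... | zone-above l   = ⊥-elim (<⇒≱ (proj₁ p) (≤-trans (≤-reflexive (above-eq s l)) (proj₂ p)))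
  ... | zone-below l   = ⊥-elim (<⇒≱ (proj₁ p) (≤-trans (≤-reflexive (below-eq s l)) (proj₂ p)))
  ... | zone-along v l = to-corner (u ∸ v) v (m+[n∸m]≡n (<⇒≤ l)) c p
  ... | zone-end       = to-corner 0 u (+-identityʳ u) c p
  connected : ∀ p q → S p → S q → Path S p q
  connected p q a b = Path-trans (cell-to-corner p a) (Path-sym (cell-to-corner q b))
  no2×2 : ∀ s c → ¬ (S (s , c) × S (s , suc c) × S (suc s , c) × S (suc s , suc c))
  no2×2 s c ((a , b) , _ , _ , (a′ , _)) with zone r u s
  ... | zone-above l   = <⇒≱ a (≤-trans (≤-reflexive (above-eq s l)) b)
  ... | zone-below l   = <⇒≱ a (≤-trans (≤-reflexive (below-eq s l)) b)
  ... | zone-along v l = <⇒≱ a′ (≤-trans (≤-reflexive (along-eq v l)) (s≤s b))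
  ... | zone-end       = <⇒≱ a′ (≤-trans (≤-reflexive (below-eq _ ≤-refl)) (≤-trans (part-antitone (proj₂ pν) (r + u)) (≤-trans b (n≤1+n c))))

hook-removable : ∀ {m μ} → IsPartition μ → HookCell m (part μ) → ∃ (RemoveRimHook m μ)
hook-removable {m} {μ} p h with HookCell⇒RimHook (part-antitone (proj₂ p)) h
... | g , rh , ag , g≤f with toPartition (length μ) g ag (n≤0⇒n≡0 (≤-trans (g≤f _) (≤-reflexive (part-[]-length μ ≤-refl))))
...   | ν , q , e = ν , RimHook⇒Remove {B = length μ} p q (part-[]-length μ ≤-refl)
          (n≤0⇒n≡0 (≤-trans (≤-reflexive (e _)) (≤-trans (g≤f _) (≤-reflexive (part-[]-length μ ≤-refl)))))
          (RimHook-resp e rh)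

-- A rim hook determines a bead move

least : ∀ {P : ℕ → Set} → (∀ s → Dec (P s)) → ∀ n → (∀ s → s < n → ¬ P s) ⊎ ∃ λ r → r < n × P r × (∀ s → s < r → ¬ P s)
least P? zero = inj₁ λ s ()
least P? (suc n) with least P? n
... | inj₂ (r , l , p , q) = inj₂ (r , m≤n⇒m≤1+n l , p , q)
... | inj₁ q with P? n
...   | yes p = inj₂ (n , ≤-refl , p , q)
...   | no ¬p = inj₁ λ s l x → go s l x (m≤n⇒m<n∨m≡n (s≤s⁻¹ l))
  where
  go : ∀ s → s < suc n → _ → s < n ⊎ s ≡ n → ⊥
  go s l x (inj₁ l′)   = q s l′ x
  go s l x (inj₂ refl) = ¬p x

greatest : ∀ {P : ℕ → Set} → (∀ s → Dec (P s)) → ∀ n {r} → r < n → P r →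
  ∃ λ j → j < n × P j × (∀ s → j < s → s < n → ¬ P s)
greatest P? (suc n) {r} l p with P? n
... | yes q = n , ≤-refl , q , λ s l₁ l₂ → ⊥-elim (<⇒≱ l₁ (s≤s⁻¹ l₂))
... | no ¬q with greatest P? n {r} (≤∧≢⇒< (s≤s⁻¹ l) λ { refl → ¬q p }) p
...   | j , l₁ , pj , q = j , m≤n⇒m≤1+n l₁ , pj , λ s l₂ l₃ x → go s l₂ x (m≤n⇒m<n∨m≡n (s≤s⁻¹ l₃))
  where
  go : ∀ s → j < s → _ → s < n ⊎ s ≡ n → ⊥
  go s l x (inj₁ l′)   = q s l l′ x
  go s l x (inj₂ refl) = ¬q x

-- A discrete intermediate value argument: a step changes the row by at most one, so some step leads
-- down from row t, within a single column.
Path-crossing : ∀ {S r c r′ c′} t → Path S (r , c) (r′ , c′) → r ≤ t → t < r′ → ∃ λ c″ → S (t , c″) × S (suc t , c″)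
Path-crossing t (here a) l l′ = ⊥-elim (<⇒≱ l′ l)
Path-crossing t (step a right w) l l′ = Path-crossing t w l l′
Path-crossing t (step a left w)  l l′ = Path-crossing t w l l′
Path-crossing t (step a up w)    l l′ = Path-crossing t w (≤-trans (n≤1+n _) l) l′
Path-crossing t (step {r , c} a down w) l l′ with m≤n⇒m<n∨m≡n l
... | inj₁ r<t  = Path-crossing t w r<t l′
... | inj₂ refl = c , a , Path-start w

-- Take the first and the last row that change. Connectedness makes consecutive rows between them
-- share a column, and the absence of 2 by 2 squares forbids a second one; this is `along`. The size
-- equation then determines `span`.
Remove⇒RimHook : ∀ {k μ ν} → IsPartition μ → RemoveRimHook (suc k) μ ν → RimHook (suc k) (part μ) (part ν)
Remove⇒RimHook {k} {μ} {ν} pμ (pν , ν≤μ , sizes , conn , no2×2) with least (λ s → part ν s <? part μ s) (length μ)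
-- If no row changed, the sizes would be equal, but they differ by the positive number `suc k`.
... | inj₁ q = ⊥-elim (m≢1+m+n (size ν) (trans (trans (sym (sumBelow-part (length μ) pν ν0))
    (trans (sumBelow-cong (length μ) (λ s l → ≤-antisym (ν≤μ s) (≮⇒≥ (q s l)))) (trans (sumBelow-part (length μ) pμ (part-[]-length μ ≤-refl)) sizes))) (+-suc (size ν) k)))
  where
  ν0 : part ν (length μ) ≡ 0
  ν0 = n≤0⇒n≡0 (≤-trans (ν≤μ _) (≤-reflexive (part-[]-length μ ≤-refl)))
... | inj₂ (r , r<n , r∈ , before) with greatest (λ s → part ν s <? part μ s) (length μ) r<n r∈
...   | j , j<n , j∈ , after = record
  { r = r ; u = u ; above = above-eq ; along = along-eq ; end = end-< ; below = below-eq
  ; span = +-cancelˡ-≡ (size ν) _ _ (begin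
      size ν + (part μ r + u)
        ≡⟨ cong₂ (λ x y → x + (part μ r + y)) (sumBelow-part (length μ) pν ν0) (*-identityʳ u) ⟨
      sumBelow (length μ) (part ν) + (part μ r + u * 1)
        ≡⟨ rows-swap r 1 {part μ} {part ν} above-eq u (λ v l → trans (along-eq v l) (+-comm 1 _)) below-eq
             (≤-trans (s≤s (≤-reflexive r+u)) j<n) ⟨
      sumBelow (length μ) (part μ) + part ν (r + u)
        ≡⟨ cong (_+ part ν (r + u)) (trans (sumBelow-part (length μ) pμ (part-[]-length μ ≤-refl)) sizes) ⟩
      size ν + suc k + part ν (r + u)
        ≡⟨ trans (+-assoc (size ν) _ _) (cong (size ν +_) (+-comm (suc k) _)) ⟩
      size ν + (part ν (r + u) + suc k) ∎)
  }
  where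
  open ≡-Reasoning
  ν0 : part ν (length μ) ≡ 0
  ν0 = n≤0⇒n≡0 (≤-trans (ν≤μ _) (≤-reflexive (part-[]-length μ ≤-refl)))
  r≤j : r ≤ j
  r≤j with r ≤? j
  ... | yes l = l
  ... | no ¬l = ⊥-elim (after r (≰⇒> ¬l) r<n r∈)
  u : ℕ
  u = j ∸ r
  r+u : r + u ≡ j
  r+u = m+[n∸m]≡n r≤j
  above-eq : ∀ s → s < r → part μ s ≡ part ν s
  above-eq s l = ≤-antisym (≮⇒≥ (before s l)) (ν≤μ s)
  below-eq : ∀ s → r + u < s → part μ s ≡ part ν s
  below-eq s l with s <? length μ
  ... | yes l′ = ≤-antisym (≮⇒≥ (after s (≤-trans (s≤s (≤-reflexive (sym r+u))) l) l′)) (ν≤μ s)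
  ... | no ¬l′ = ≤-antisym (≤-trans (≤-reflexive (part-[]-length μ (≮⇒≥ ¬l′))) z≤n) (ν≤μ s)
  end-< : part ν (r + u) < part μ (r + u)
  end-< = subst (λ z → part ν z < part μ z) (sym r+u) j∈
  path : Path (InSkew μ ν) (r , part ν r) (j , part ν j)
  path = conn _ _ (r∈ , ≤-refl) (j∈ , ≤-refl)
  along-eq : ∀ v → v < u → part μ (suc (r + v)) ≡ suc (part ν (r + v))
  along-eq v l with Path-crossing (r + v) path (m≤m+n r v) (≤-trans (≤-reflexive (sym (+-suc r v))) (≤-trans (+-monoʳ-≤ r l) (≤-reflexive r+u)))
  ... | c , (_ , b) , (a , _) = ≤-antisym
        (≮⇒≥ λ l′ → no2×2 (r + v) (part ν (r + v))
          ( ( <-trans ≤-refl (<-≤-trans l′ μ↓) , ≤-refl)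
          , ( <-≤-trans l′ μ↓ , n≤1+n _)
          , ( <-trans ≤-refl l′ , part-antitone (proj₂ pν) (r + v))
          , ( l′ , ≤-trans (part-antitone (proj₂ pν) (r + v)) (n≤1+n _))))
        (≤-trans (s≤s b) a)
    where
    μ↓ : part μ (suc (r + v)) ≤ part μ (r + v)
    μ↓ = part-antitone (proj₂ pμ) (r + v)

conjPart-accept : ∀ {x μ c} → c < x → conjPart (x ∷ μ) c ≡ suc (conjPart μ c)
conjPart-accept {c = c} l = cong length (List.filter-accept (c <?_) l)

conjPart-reject : ∀ {x μ c} → ¬ c < x → conjPart (x ∷ μ) c ≡ conjPart μ c
conjPart-reject {c = c} l = cong length (List.filter-reject (c <?_) l)

conjPart-< : ∀ μ {s c} → Linked _≥_ μ → c < part μ s → s < conjPart μ c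
conjPart-< (x ∷ μ) {s} {c} l p with c <? x
conjPart-< (x ∷ μ) {zero}  l p | yes q = ≤-trans (s≤s z≤n) (≤-reflexive (sym (conjPart-accept q)))
conjPart-< (x ∷ μ) {suc s} l p | yes q = ≤-trans (s≤s (conjPart-< μ (Linked.tail l) p)) (≤-reflexive (sym (conjPart-accept q)))
conjPart-< (x ∷ μ) {s} l p | no ¬q = ⊥-elim (¬q (≤-trans p (antitone-≤ (part-antitone l) {0} {s} z≤n)))

conjPart-≥ : ∀ μ {s c} → Linked _≥_ μ → part μ s ≤ c → conjPart μ c ≤ s
conjPart-≥ [] l p = z≤n
conjPart-≥ (x ∷ μ) {s} {c} l p with c <? x
conjPart-≥ (x ∷ μ) {zero}  l p | yes q = ⊥-elim (<⇒≱ q p)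
conjPart-≥ (x ∷ μ) {suc s} l p | yes q = ≤-trans (≤-reflexive (conjPart-accept q)) (s≤s (conjPart-≥ μ (Linked.tail l) p))
conjPart-≥ (x ∷ μ) {s} l p | no ¬q = ≤-trans (≤-reflexive (conjPart-reject ¬q))
  (≤-trans (conjPart-≥ μ {0} (Linked.tail l) (≤-trans (part-antitone l 0) (≮⇒≥ ¬q))) z≤n)

core⇒no-hook : ∀ {m μ} → IsPartition μ → IsCore m μ → ¬ HookCell m (part μ)
core⇒no-hook {m} {μ} (_ , l) core (hookCell r u c i b s) = core r c c<
  (trans (cong (λ z → part μ r ∸ suc c + (z ∸ suc r) + 1) (≤-antisym (conjPart-≥ μ l b) (conjPart-< μ l i)))
  (trans (cong (λ z → part μ r ∸ suc c + z + 1) (m+n∸m≡n r u))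
  (+-cancelʳ-≡ c _ _ (trans (lem (part μ r ∸ suc c) u c) (trans (cong (_+ u) (m∸n+n≡m c<)) (trans s (+-comm c m)))))))
  where
  c< : c < part μ r
  c< = ≤-trans i (antitone-+ (part-antitone l) r u)
  lem : ∀ a u c → a + u + 1 + c ≡ a + suc c + u
  lem = solve-∀

-- Cores and charges

charge-remove : ∀ {k μ ν} B → IsPartition μ → part μ B ≡ 0 → RemoveRimHook (suc k) μ ν →
  part ν B ≡ 0 × charge k (diffs B (part μ)) ≡ charge k (diffs B (part ν))
charge-remove B p e h@(q , l , _) = e′ , RimHook-charge B (part-antitone (proj₂ p)) (part-antitone (proj₂ q)) e e′ (Remove⇒RimHook p h)
  where
  e′ = n≤0⇒n≡0 (≤-trans (l B) (≤-reflexive e))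

charge-core : ∀ {k μ ν} B → IsPartition μ → part μ B ≡ 0 → Star (RemoveRimHook (suc k)) μ ν →
  charge k (diffs B (part μ)) ≡ charge k (diffs B (part ν))
charge-core B p e ε = refl
charge-core B p e (h ◅ hs) = let e′ , c = charge-remove B p e h in trans c (charge-core B (proj₁ h) e′ hs)

diffs-injective : ∀ B {μ ν} → IsPartition μ → IsPartition ν → part μ B ≡ 0 → part ν B ≡ 0 →
  diffs B (part μ) ≡ diffs B (part ν) → μ ≡ ν
diffs-injective B p q e e′ eq = part-injective p q λ s →
  trans (sym (partOf-diffs-0 B (part-antitone (proj₂ p)) e s))
  (trans (cong (λ d → partOf d s) eq) (partOf-diffs-0 B (part-antitone (proj₂ q)) e′ s))

flat-or-hook-part : ∀ {k} B {μ} → IsPartition μ → part μ B ≡ 0 →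
  Flat (runners {k} (diffs B (part μ))) ⊎ HookCell (suc k) (part μ)
flat-or-hook-part B {μ} p e with flat-or-hook (diffs B (part μ))
... | inj₁ f = inj₁ f
... | inj₂ h = inj₂ (HookCell-resp (partOf-diffs-0 B (part-antitone (proj₂ p)) e) h)

core-flat : ∀ {k} B {λc} → IsPartition λc → part λc B ≡ 0 → IsCore (suc k) λc → Flat (runners {k} (diffs B (part λc)))
core-flat B p e core with flat-or-hook-part B p e
... | inj₁ f = f
... | inj₂ h = ⊥-elim (core⇒no-hook p core h)

-- Hooks are removed until the configuration is flat. The charge is unchanged and determines a flat
-- configuration, so the process ends at `λc` whatever hooks were chosen.
core-charge : ∀ {k} B {μ λc} → IsPartition μ → IsPartition λc → part μ B ≡ 0 → part λc B ≡ 0 → IsCore (suc k) λc →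
  charge k (diffs B (part μ)) ≡ charge k (diffs B (part λc)) → Star (RemoveRimHook (suc k)) μ λc
core-charge {k} B {μ} {λc} pμ pλ eμ eλ core = go (size μ) pμ eμ ≤-refl
  where
  go : ∀ n {μ} → IsPartition μ → part μ B ≡ 0 → size μ ≤ n →
    charge k (diffs B (part μ)) ≡ charge k (diffs B (part λc)) → Star (RemoveRimHook (suc k)) μ λc
  go n {μ} p e l ch with flat-or-hook-part {k} B p e
  ... | inj₁ f = subst (Star (RemoveRimHook (suc k)) μ)
        (diffs-injective B p pλ e eλ (runners-injective {k} _ _ (trans f (trans (cong flatten ch) (sym (core-flat B pλ eλ core)))))) ε
  ... | inj₂ h with hook-removable p h
  go zero {μ} p e l ch | inj₂ h | ν , rr@(_ , _ , sz , _) = ⊥-elim (<⇒≱ (≤-<-trans z≤n (m<m+n (size ν) z<s)) (≤-trans (≤-reflexive (sym sz)) l))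
  go (suc n) {μ} p e l ch | inj₂ h | ν , rr@(q , _ , sz , _) =
    let e′ , c = charge-remove B p e rr in
    rr ◅ go n q e′ (s≤s⁻¹ (≤-trans (m<m+n (size ν) z<s) (≤-trans (≤-reflexive (sym sz)) l))) (trans (sym c) ch)

-- Generating functions of lists of gaps

-- The gap with `i - 1` beads above its own adds `i` per unit to `gapSize`, so it is the
-- multiplicity of the part i in a partition with parts at most `x`. The parameter `a` decides
-- whether t marks the number of parts.
GF-lists : ∀ a k x → GF {List ℕ} (λ δ → length δ ≡ x) (λ δ → a * sum δ) (λ δ → suc k * gapSize δ) (prodTo x (λ i → geom a (suc k * i)))
GF-lists a k zero = GF-bij GF-one (λ _ → []) (λ _ → tt) (λ _ → refl , *-zeroʳ a , *-zeroʳ (suc k) , refl) (λ { {[]} refl → tt , refl })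
GF-lists a k (suc x) = GF-bij (GF-⊛ (GF-lists a k x) (GF-geom a (suc k * suc x) z<s))
  (λ (δ , y) → y ∷ δ) (λ { [] → [] , 0 ; (y ∷ δ) → δ , y })
  (λ { {δ , y} (refl , _) → refl , lem₁ a y (sum δ) , lem₂ (suc k) y (length δ) (gapSize δ) , refl })
  (λ { {y ∷ δ} refl → (refl , tt) , refl })
  where
  lem₁ : ∀ a y s → a * (y + s) ≡ a * s + a * y
  lem₁ = solve-∀
  lem₂ : ∀ m y l s → m * (y * suc l + s) ≡ m * s + m * suc l * y
  lem₂ = solve-∀

partitions : ℕ → ℕ → ℕ → Series
partitions a k N = prodTo N (λ i → geom a (suc k * i))

prodV : ∀ {n} → ℕ → Vec ℕ n → Series
prodV k []      = one
prodV k (x ∷ c) = partitions 0 k x ⊛ prodV k c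

sizes : ∀ {n} → Vec (List ℕ) n → ℕ
sizes []       = 0
sizes (δ ∷ δs) = gapSize δ + sizes δs

GF-vec : ∀ {n} k (c : Vec ℕ n) → GF (λ δs → Vec.map length δs ≡ c) (λ _ → 0) (λ δs → suc k * sizes δs) (prodV k c)
GF-vec k [] = GF-bij GF-one (λ _ → []) (λ _ → tt) (λ _ → refl , refl , *-zeroʳ (suc k) , refl) (λ { {[]} refl → tt , refl })
GF-vec k (x ∷ c) = GF-bij (GF-⊛ (GF-lists 0 k x) (GF-vec k c))
  (λ (δ , δs) → δ ∷ δs) (λ { (δ ∷ δs) → δ , δs })
  (λ { {δ , δs} (refl , refl) → refl , refl , *-distribˡ-+ (suc k) (gapSize δ) (sizes δs) , refl })
  (λ { {δ ∷ δs} refl → (refl , refl) , refl })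

gapSize-zeros : ∀ n → gapSize (zeros n) ≡ 0
gapSize-zeros zero    = refl
gapSize-zeros (suc n) = gapSize-zeros n

energies-flatten : ∀ {n} m i (δs : Vec (List ℕ) n) →
  energies m i δs ≡ energies m i (flatten (Vec.map length δs)) + m * sizes δs
energies-flatten m i [] = sym (*-zeroʳ m)
energies-flatten m i (δ ∷ δs) = begin
  i * length δ + m * (gapSize δ + triangle (length δ)) + energies m (suc i) δs
    ≡⟨ cong (i * length δ + m * (gapSize δ + triangle (length δ)) +_) (energies-flatten m (suc i) δs) ⟩
  i * length δ + m * (gapSize δ + triangle (length δ)) + (energies m (suc i) (flatten (Vec.map length δs)) + m * sizes δs)
    ≡⟨ lem (i * length δ) m (gapSize δ) (triangle (length δ)) (energies m (suc i) (flatten (Vec.map length δs))) (sizes δs) ⟩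
  i * length δ + m * (0 + triangle (length δ)) + energies m (suc i) (flatten (Vec.map length δs)) + m * (gapSize δ + sizes δs)
    ≡⟨ cong₂ (λ a b → i * a + m * (b + triangle a) + energies m (suc i) (flatten (Vec.map length δs)) + m * (gapSize δ + sizes δs))
         (List.length-replicate (length δ)) (gapSize-zeros (length δ)) ⟨
  i * length (zeros (length δ)) + m * (gapSize (zeros (length δ)) + triangle (length (zeros (length δ))))
    + energies m (suc i) (flatten (Vec.map length δs)) + m * (gapSize δ + sizes δs) ∎
  where
  open ≡-Reasoning
  lem : ∀ il m s t e z → il + m * (s + t) + (e + m * z) ≡ il + m * (0 + t) + e + m * (s + z)
  lem = solve-∀

length-charge : ∀ {k} d → length d ≡ Vec.sum (charge k d)
length-charge {k} d = trans (sym (total-runners {k} d)) (go (runners d))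
  where
  go : ∀ {n} (v : Vec (List ℕ) n) → total v ≡ Vec.sum (Vec.map length v)
  go []      = refl
  go (δ ∷ v) = cong (length δ +_) (go v)

length-charge-≡ : ∀ {k} d d′ → charge k d ≡ charge k d′ → length d ≡ length d′
length-charge-≡ {k} d d′ e = trans (length-charge {k} d) (trans (cong Vec.sum e) (sym (length-charge {k} d′)))

-- |μ| = |λ| + m (|μ⁽⁰⁾| + … + |μ⁽ᵐ⁻¹⁾|) for the m-core λ and the m-quotient of μ.
gapSize-quotient : ∀ {k} d d₀ → Flat (runners {k} d₀) → charge k d ≡ charge k d₀ →
  gapSize d ≡ gapSize d₀ + suc k * sizes (runners {k} d)
gapSize-quotient {k} d d₀ flat e = +-cancelʳ-≡ (triangle (length d)) _ _ (begin
  gapSize d + triangle (length d)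
    ≡⟨ energies-runners {k} d ⟨
  energies (suc k) 0 (runners {k} d)
    ≡⟨ energies-flatten (suc k) 0 (runners {k} d) ⟩
  energies (suc k) 0 (flatten (charge k d)) + suc k * sizes (runners {k} d)
    ≡⟨ cong (λ v → energies (suc k) 0 v + suc k * sizes (runners {k} d)) (trans (cong flatten e) (sym flat)) ⟩
  energies (suc k) 0 (runners {k} d₀) + suc k * sizes (runners {k} d)
    ≡⟨ cong (_+ suc k * sizes (runners {k} d)) (energies-runners {k} d₀) ⟩
  gapSize d₀ + triangle (length d₀) + suc k * sizes (runners {k} d)
    ≡⟨ cong (λ z → gapSize d₀ + triangle z + suc k * sizes (runners {k} d)) (length-charge-≡ {k} d d₀ e) ⟨
  gapSize d₀ + triangle (length d) + suc k * sizes (runners {k} d)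
    ≡⟨ lem (gapSize d₀) (triangle (length d)) (suc k * sizes (runners {k} d)) ⟩
  gapSize d₀ + suc k * sizes (runners {k} d) + triangle (length d) ∎)
  where
  open ≡-Reasoning
  lem : ∀ a b c → a + b + c ≡ a + c + b
  lem = solve-∀

GF-charge : ∀ {k} d₀ → Flat (runners {k} d₀) →
  GF (λ d → charge k d ≡ charge k d₀) (λ _ → 0) gapSize (mono 0 (gapSize d₀) ⊛ prodV k (charge k d₀))
GF-charge {k} d₀ flat = GF-bij (GF-⊛ (GF-mono 0 (gapSize d₀)) (GF-vec k (charge k d₀)))
  (λ (_ , v) → unrun v) (λ d → tt , runners d)
  (λ { {_ , v} (_ , e) → let e′ = trans (cong (Vec.map length) (run v)) e in
       e′ , refl , trans (gapSize-quotient (unrun v) d₀ flat e′) (cong (λ w → gapSize d₀ + suc k * sizes w) (run v)) ,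
       cong (tt ,_) (run v) })
  (λ {d} e → (tt , e) , runners-injective {k} _ _ (run (runners d)))
  where
  unrun : Vec (List ℕ) (suc k) → List ℕ
  unrun v = proj₁ (runners-surjective v)
  run : ∀ v → runners (unrun v) ≡ v
  run v = proj₂ (runners-surjective v)

partitions-extend : ∀ {N M} a k → N ≤ M → partitions a k M ≈[ N ] partitions a k N
partitions-extend a k l = prodTo-extend _ (≤⇒≤′ l) (λ i N<i → geom≈one a (suc k * i) (<-≤-trans N<i (m≤n*m i (suc k))))

-- With at least N beads on a runner, its factor agrees with the full partition series up to degree
-- N, so the individual bead numbers disappear.
prodV-≈ : ∀ {N k n} {c : Vec ℕ n} → VAll.All (N ≤_) c → prodV k c ≈[ N ] pow (partitions 0 k N) n
prodV-≈ [] = ≈-refl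
prodV-≈ {N} {k} {suc n} {x ∷ c} (l ∷ ls) = ≈-trans (⊛-cong (partitions-extend 0 k l) (prodV-≈ {c = c} ls)) (⊛-comm (partitions 0 k N) (pow (partitions 0 k N) n))

-- Dividing the gaps by m

combine : ℕ → List ℕ → List ℕ → List ℕ
combine k = List.zipWith (λ r e → r + e * suc k)

charge-combine : ∀ {k} r e → length r ≡ length e → charge k (combine k r e) ≡ charge k r
charge-combine [] [] _ = refl
charge-combine {k} (x ∷ r) (y ∷ e) l = begin
  charge k (x + y * suc k ∷ combine k r e)
    ≡⟨ charge-∷ (x + y * suc k) (combine k r e) ⟩
  rotN id (x + y * suc k) (rot suc (charge k (combine k r e)))
    ≡⟨ rotN-+ id x (y * suc k) _ ⟩
  rotN id x (rotN id (y * suc k) (rot suc (charge k (combine k r e))))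
    ≡⟨ cong (rotN id x) (rotN-periods y _) ⟩
  rotN id x (rot suc (charge k (combine k r e)))
    ≡⟨ cong (λ v → rotN id x (rot suc v)) (charge-combine r e (suc-injective l)) ⟩
  rotN id x (rot suc (charge k r))
    ≡⟨ charge-∷ x r ⟨
  charge k (x ∷ r) ∎
  where open ≡-Reasoning

length-combine : ∀ {k} r e → length r ≡ length e → length (combine k r e) ≡ length r
length-combine [] [] _ = refl
length-combine (x ∷ r) (y ∷ e) l = cong suc (length-combine r e (suc-injective l))

gapSize-combine : ∀ {k} r e → length r ≡ length e → gapSize (combine k r e) ≡ gapSize r + suc k * gapSize e
gapSize-combine {k} [] [] _ = sym (*-zeroʳ (suc k))
gapSize-combine {k} (x ∷ r) (y ∷ e) l = begin
  (x + y * suc k) * suc (length (combine k r e)) + gapSize (combine k r e)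
    ≡⟨ cong₂ (λ a b → (x + y * suc k) * suc a + b) (length-combine r e (suc-injective l)) (gapSize-combine r e (suc-injective l)) ⟩
  (x + y * suc k) * suc (length r) + (gapSize r + suc k * gapSize e)
    ≡⟨ lem x y k (length r) (gapSize r) (gapSize e) ⟩
  x * suc (length r) + gapSize r + suc k * (y * suc (length r) + gapSize e)
    ≡⟨ cong (λ z → x * suc (length r) + gapSize r + suc k * (y * z + gapSize e)) l ⟩
  x * suc (length r) + gapSize r + suc k * (y * suc (length e) + gapSize e) ∎
  where
  open ≡-Reasoning
  lem : ∀ x y k l s t → (x + y * suc k) * suc l + (s + suc k * t) ≡ x * suc l + s + suc k * (y * suc l + t)
  lem = solve-∀

remainders quotients : ℕ → List ℕ → List ℕ
remainders k = map (_% suc k)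
quotients  k = map (_/ suc k)

remainders-combine : ∀ {k} r e → length r ≡ length e → All (_< suc k) r → remainders k (combine k r e) ≡ r
remainders-combine [] [] _ _ = refl
remainders-combine {k} (x ∷ r) (y ∷ e) l (p ∷ ps) =
  cong₂ _∷_ (trans ([m+kn]%n≡m%n x y (suc k)) (m<n⇒m%n≡m p)) (remainders-combine r e (suc-injective l) ps)

quotients-combine : ∀ {k} r e → length r ≡ length e → All (_< suc k) r → quotients k (combine k r e) ≡ e
quotients-combine [] [] _ _ = refl
quotients-combine {k} (x ∷ r) (y ∷ e) l (p ∷ ps) = cong₂ _∷_
  (trans (+-distrib-/-∣ʳ x (divides y refl)) (trans (cong₂ _+_ (m<n⇒m/n≡0 p) (m*n/n≡m y (suc k))) refl))
  (quotients-combine r e (suc-injective l) ps)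

combine-divMod : ∀ k d → combine k (remainders k d) (quotients k d) ≡ d
combine-divMod k []      = refl
combine-divMod k (x ∷ d) = cong₂ _∷_ (sym (m≡m%n+[m/n]*n x (suc k))) (combine-divMod k d)

remainders-< : ∀ k d → All (_< suc k) (remainders k d)
remainders-< k []      = []
remainders-< k (x ∷ d) = m%n<n x (suc k) ∷ remainders-< k d

RestrictedCharge : ∀ k → List ℕ → List ℕ → Set
RestrictedCharge k d₀ d = charge k d ≡ charge k d₀ × All (_< suc k) d

GF-divide : ∀ {k} d₀ {F} a → GF (RestrictedCharge k d₀) (λ _ → 0) gapSize F →
  GF (λ d → charge k d ≡ charge k d₀) (λ d → a * sum (quotients k d)) gapSize (F ⊛ partitions a k (length d₀))
GF-divide {k} d₀ a p = GF-bij (GF-⊛ p (GF-lists a k (length d₀)))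
  (λ (r , e) → combine k r e) (λ d → remainders k d , quotients k d)
  (λ { {r , e} ((c , s) , l) → let l′ = trans (length-charge-≡ {k} r d₀ c) (sym l) in
       trans (charge-combine r e l′) c , cong (λ z → a * sum z) (quotients-combine r e l′ s) , gapSize-combine r e l′ ,
       cong₂ _,_ (remainders-combine r e l′ s) (quotients-combine r e l′ s) })
  (λ {d} c → let lr = List.length-map (_% suc k) d ; lq = List.length-map (_/ suc k) d in
     ( (trans (trans (sym (charge-combine (remainders k d) (quotients k d) (trans lr (sym lq)))) (cong (charge k) (combine-divMod k d))) c
       , remainders-< k d)
     , trans lq (length-charge-≡ {k} d d₀ c))
     , combine-divMod k d)

-- Existence only: the finite sets counted by `GF-charge` are filtered by a decidable condition. The
-- closed form is the content of `GF-restricted`.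
restricted-series : ∀ {k} d₀ → Flat (runners {k} d₀) → ∃ (GF (RestrictedCharge k d₀) (λ _ → 0) gapSize)
restricted-series {k} d₀ flat = (λ i n → proj₁ (filtered i n)) , λ i n →
  Card-⇔ (λ ((c , i , n) , r) → (c , r) , i , n) (λ ((c , r) , i , n) → (c , i , n) , r) (proj₂ (filtered i n))
  where
  filtered : ∀ i n → ∃ (Card (λ d → (charge k d ≡ charge k d₀ × 0 ≡ i × gapSize d ≡ n) × All (_< suc k) d))
  filtered i n = Card-filter (All.all? (_<? suc k)) (GF-charge d₀ flat i n)

module _ {k N : ℕ} (d₀ : List ℕ) (flat : Flat (runners {k} d₀)) (N≤c : VAll.All (N ≤_) (charge k d₀)) (N≤B : N ≤ length d₀) where

  private
    m₀ : Series
    m₀ = mono 0 (gapSize d₀)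
    P : Series
    P = partitions 0 k N

  GF-restricted : ∀ {F} → GF (RestrictedCharge k d₀) (λ _ → 0) gapSize F →
    F ≈[ N ] m₀ ⊛ prodTo N (λ i → pow (geom 0 (suc k * i)) k)
  GF-restricted {F} p = ≈-trans
    (⊛-cancelʳ {F = F} {F′ = m₀ ⊛ pow P k} {G = P}
      (Monic-prodTo N (λ i 0<i → geom≈one 0 (suc k * i) (<-≤-trans 0<i (m≤n*m i (suc k)))))
      (≈-trans (⊛-cong {F = F} ≈-refl (≈-sym (partitions-extend 0 k N≤B)))
      -- For `a = 0` the weight `0 * sum …` is definitionally 0, so division and the abacus count
      -- the same set with the same weights.
      (≈-trans (GF-unique (GF-divide d₀ 0 p) (GF-charge d₀ flat))
      (≈-trans (⊛-cong {F = m₀} ≈-refl (prodV-≈ N≤c)) (≈-sym (⊛-assoc m₀ (pow P k) P))))))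
    (⊛-cong {F = m₀} ≈-refl (≈-sym (prodTo-pow N (λ i → geom 0 (suc k * i)) k)))

  GF-weighted : ∀ {F} → GF (λ d → charge k d ≡ charge k d₀) (λ d → 1 * sum (quotients k d)) gapSize F →
    F ≈[ N ] m₀ ⊛ prodTo N (λ i → pow (geom 0 (suc k * i)) k ⊛ geom 1 (suc k * i))
  GF-weighted p = let R , r = restricted-series d₀ flat ; Q = prodTo N (λ i → pow (geom 0 (suc k * i)) k) in
    ≈-trans (GF-unique p (GF-divide d₀ 1 r))
    (≈-trans (⊛-cong (GF-restricted r) (partitions-extend 1 k N≤B))
    (≈-trans (⊛-assoc m₀ Q (partitions 1 k N))
    (⊛-cong {F = m₀} ≈-refl (≈-sym (prodTo-⊛ N (λ i → pow (geom 0 (suc k * i)) k) (λ i → geom 1 (suc k * i)))))))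

-- Counting the cells with leg 0

-- The shape of `cells` with the list of row indices left free, as induction over that list
-- requires.
cell-list : (ℕ → List ℕ) → List ℕ → List Cell
cell-list h = concatMap (λ r → map (r ,_) (h r))

∈-cell-list⁺ : ∀ h {rs r c} → r ∈ rs → c ∈ h r → (r , c) ∈ cell-list h rs
∈-cell-list⁺ h {r ∷ rs} (here refl) q = ∈-++⁺ˡ (∈-map⁺ (r ,_) q)
∈-cell-list⁺ h {r ∷ rs} (there p)   q = ∈-++⁺ʳ (map (r ,_) (h r)) (∈-cell-list⁺ h p q)

∈-cell-list⁻ : ∀ h rs {r c} → (r , c) ∈ cell-list h rs → r ∈ rs × c ∈ h r
∈-cell-list⁻ h (r ∷ rs) p with ∈-++⁻ (map (r ,_) (h r)) p
... | inj₁ q with _ , c∈ , refl ← ∈-map⁻ (r ,_) q = here refl , c∈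
... | inj₂ q = let a , b = ∈-cell-list⁻ h rs q in there a , b

cell-list-unique : ∀ h {rs} → Unique rs → (∀ r → Unique (h r)) → Unique (cell-list h rs)
cell-list-unique h {[]} [] u = []
cell-list-unique h {r ∷ rs} u@(_ ∷ us) v = Uniq.++⁺ (Uniq.map⁺ (λ { refl → refl }) (v r)) (cell-list-unique h us v) disjoint
  where
  disjoint : ∀ {p} → ¬ (p ∈ map (r ,_) (h r) × p ∈ cell-list h rs)
  disjoint (a , b) with _ , _ , refl ← ∈-map⁻ (r ,_) a =
    Uniq.Unique[x∷xs]⇒x∉xs u (proj₁ (∈-cell-list⁻ h rs b))

Card-cells : ∀ μ {Q : Cell → Set} (Q? : ∀ p → Dec (Q p)) →
  Card (λ p → proj₂ p < part μ (proj₁ p) × Q p) (length (filter Q? (cells μ)))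
Card-cells μ {Q} Q? = mkCard (filter Q? (cells μ))
  (Uniq.filter⁺ Q? (cell-list-unique row (Uniq.upTo⁺ (length μ)) (λ r → Uniq.upTo⁺ (part μ r))))
  (λ p → let a , q = ∈-filter⁻ Q? p in ∈-upTo⁻ (proj₂ (∈-cell-list⁻ row (upTo (length μ)) a)) , q)
  (λ { {r , c} (l , q) → ∈-filter⁺ Q? (∈-cell-list⁺ row (∈-upTo⁺ (≰⇒> λ l′ → <⇒≱ (≤-<-trans z≤n l) (≤-reflexive (part-[]-length μ l′)))) (∈-upTo⁺ l)) q })
  refl
  where
  row : ℕ → List ℕ
  row r = upTo (part μ r)

Card-sumBelow : ∀ (e : ℕ → ℕ) B → Card {ℕ × ℕ} (λ (r , j) → r < B × j < e r) (sumBelow B e)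
Card-sumBelow e zero = mkCard [] [] (λ ()) (λ ()) refl
Card-sumBelow e (suc B) = Card-⇔
  (λ { (inj₁ (l , l′)) → m≤n⇒m≤1+n l , l′ ; (inj₂ (refl , l)) → ≤-refl , l })
  back
  (Card-⊎ (λ { (l , _) (refl , _) → <-irrefl refl l }) (Card-sumBelow e B)
    (Card-bij {P = _< e B} {Q = λ (r , j) → r ≡ B × j < e r} (B ,_) (λ l → refl , l) (λ { _ _ refl → refl })
      (λ { {_ , j} (refl , l) → j , l , refl })
      (mkCard (upTo (e B)) (Uniq.upTo⁺ (e B)) ∈-upTo⁻ ∈-upTo⁺ (List.length-upTo (e B)))))
  where
  back : ∀ {p : ℕ × ℕ} → proj₁ p < suc B × proj₂ p < e (proj₁ p) → (proj₁ p < B × proj₂ p < e (proj₁ p)) ⊎ (proj₁ p ≡ B × proj₂ p < e (proj₁ p))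
  back {r , j} (l , l′) with m≤n⇒m<n∨m≡n (s≤s⁻¹ l)
  ... | inj₁ l″ = inj₁ (l″ , l′)
  ... | inj₂ e  = inj₂ (e , l′)

leg-0⇒ : ∀ {μ} r c → Linked _≥_ μ → leg μ r c ≡ 0 → part μ (suc r) ≤ c
leg-0⇒ {μ} r c l e = ≮⇒≥ λ p → <⇒≱ (conjPart-< μ l p) (m∸n≡0⇒m≤n e)

⇒leg-0 : ∀ {μ} r c → Linked _≥_ μ → part μ (suc r) ≤ c → leg μ r c ≡ 0
⇒leg-0 {μ} r c l p = m≤n⇒m∸n≡0 (conjPart-≥ μ l p)

suc-arm : ∀ μ r c → c < part μ r → suc (arm μ r c) ≡ part μ r ∸ c
suc-arm μ r c l = sym (∸-suc l)

-- The cells counted in row r are those at distance m, 2m, … from its end.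
hm0-rows : ∀ k μ B → IsPartition μ → part μ B ≡ 0 →
  hm0 (suc k) μ ≡ sumBelow B (λ r → (part μ r ∸ part μ (suc r)) / suc k)
hm0-rows k μ B (_ , l) e = sym (Card-unique (Card-bij (λ (r , j) → r , part μ r ∸ suc j * suc k) to inj surj (Card-sumBelow _ B)) (Card-cells μ _))
  where
  f : ℕ → ℕ
  f = part μ
  fits : ∀ {r j} → j < (f r ∸ f (suc r)) / suc k → suc j * suc k ≤ f r ∸ f (suc r)
  fits {r} p = ≤-trans (*-monoˡ-≤ (suc k) p) (m/n*n≤m (f r ∸ f (suc r)) (suc k))
  fits′ : ∀ {r j} → j < (f r ∸ f (suc r)) / suc k → suc j * suc k ≤ f r
  fits′ {r} p = ≤-trans (fits p) (m∸n≤m (f r) (f (suc r)))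
  to : ∀ {p} → proj₁ p < B × proj₂ p < (f (proj₁ p) ∸ f (suc (proj₁ p))) / suc k →
    let r , j = p ; c = f r ∸ suc j * suc k in c < f r × leg μ r c ≡ 0 × suc k ∣ suc (arm μ r c)
  -- A leg is 0 exactly when the column is not reached by the next row, so arm plus one is at most
  -- the difference of the two rows.
  to {r , j} (_ , p) = c< , ⇒leg-0 r _ l
      (≤-trans (≤-reflexive (sym (m∸[m∸n]≡n (part-antitone l r)))) (∸-monoʳ-≤ (f r) (fits p))) ,
    divides (suc j) (trans (suc-arm μ r _ c<) (m∸[m∸n]≡n (fits′ p)))
    where
    c< : f r ∸ suc j * suc k < f r
    c< = ∸-monoʳ-< {f r} {suc j * suc k} {0} z<s (fits′ p)
  inj : ∀ {p q} → proj₁ p < B × proj₂ p < (f (proj₁ p) ∸ f (suc (proj₁ p))) / suc k →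
    proj₁ q < B × proj₂ q < (f (proj₁ q) ∸ f (suc (proj₁ q))) / suc k →
    (proj₁ p , f (proj₁ p) ∸ suc (proj₂ p) * suc k) ≡ (proj₁ q , f (proj₁ q) ∸ suc (proj₂ q) * suc k) → p ≡ q
  inj {r , j} {r′ , j′} (_ , p) (_ , q) eq with refl ← cong proj₁ eq =
    cong (r ,_) (suc-injective (*-cancelʳ-≡ (suc j) (suc j′) (suc k) (∸-cancelˡ-≡ (fits′ p) (fits′ q) (cong proj₂ eq))))
  surj : ∀ {p} → proj₂ p < f (proj₁ p) × leg μ (proj₁ p) (proj₂ p) ≡ 0 × suc k ∣ suc (arm μ (proj₁ p) (proj₂ p)) →
    ∃ λ q → (proj₁ q < B × proj₂ q < (f (proj₁ q) ∸ f (suc (proj₁ q))) / suc k) × (proj₁ q , f (proj₁ q) ∸ suc (proj₂ q) * suc k) ≡ p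
  -- The quotient is not 0 because arm plus one is positive; its predecessor is the index `j`.
  surj {r , c} (c< , lg , divides (suc j) eq) = (r , j) , (end<B {f} {λ _ → 0} (part-antitone l) e (≤-<-trans z≤n c<) ,
      ≤-trans (≤-reflexive (sym (m*n/n≡m (suc j) (suc k))))
        (/-monoˡ-≤ (suc k) (≤-trans (≤-reflexive q) (∸-monoʳ-≤ (f r) (leg-0⇒ r c l lg))))) ,
    cong (r ,_) (trans (cong (f r ∸_) q) (m∸[m∸n]≡n (<⇒≤ c<)))
    where
    q : suc j * suc k ≡ f r ∸ c
    q = trans (sym eq) (suc-arm μ r c c<)

sum-quotients : ∀ k B f → sum (quotients k (diffs B f)) ≡ sumBelow B (λ r → (f r ∸ f (suc r)) / suc k)
sum-quotients k zero    f = refl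
sum-quotients k (suc B) f = trans (cong ((f B ∸ f (suc B)) / suc k +_) (sum-quotients k B f)) (+-comm ((f B ∸ f (suc B)) / suc k) _)

hm0-quotients : ∀ k {μ} B → IsPartition μ → part μ B ≡ 0 → hm0 (suc k) μ ≡ 1 * sum (quotients k (diffs B (part μ)))
hm0-quotients k {μ} B p e = trans (hm0-rows k μ B p e) (trans (sym (sum-quotients k B (part μ))) (sym (*-identityˡ _)))

-- Padding with empty rows and the final count

charge-pad : ∀ {k} μ t → charge k (diffs (t + length μ) (part μ)) ≡ rotN suc t (charge k (diffs (length μ) (part μ)))
charge-pad μ zero    = refl
-- An additional empty row is a lowest bead with gap 0, that is, a bead at position 0.
charge-pad {k} μ (suc t) = trans
  (cong (λ x → charge k (x ∷ diffs (t + length μ) (part μ)))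
    (cong₂ _∸_ (part-[]-length μ (m≤n+m (length μ) t)) (part-[]-length μ (m≤n⇒m≤1+n (m≤n+m (length μ) t)))))
  (trans (charge-0∷ (diffs (t + length μ) (part μ))) (cong (rot suc) (charge-pad μ t)))

-- Adding m empty rows puts one more bead on every runner.
rotN-suc-≥ : ∀ {k} N (v : Vec ℕ (suc k)) → VAll.All (N ≤_) (rotN suc (N * suc k) v)
rotN-suc-≥ zero    v = VAll.universal (λ _ → z≤n) v
rotN-suc-≥ {k} (suc N) v = subst (VAll.All (suc N ≤_)) (sym (trans (rotN-+ suc (suc k) (N * suc k) v) (rotN-full suc _)))
  (VAllP.map⁺ (VAll.map s≤s (rotN-suc-≥ N v)))

length≤size : ∀ {μ} → All (0 <_) μ → length μ ≤ size μ
length≤size []       = z≤n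
length≤size (p ∷ ps) = +-mono-≤ p (length≤size ps)

part-≥size : ∀ {μ B} → IsPartition μ → size μ ≤ B → part μ B ≡ 0
part-≥size {μ} (p , _) l = part-[]-length μ (≤-trans (length≤size p) l)

restricted⇒All : ∀ {m} μ B → Restricted m μ → All (_< m) (diffs B (part μ))
restricted⇒All μ zero    r = []
restricted⇒All μ (suc B) r = r B ∷ restricted⇒All μ B r

All⇒restricted : ∀ {k μ} B → IsPartition μ → part μ B ≡ 0 → All (_< suc k) (diffs B (part μ)) → Restricted (suc k) μ
All⇒restricted {k} {μ} B p e a i with i <? B
... | yes l = go B l a
  where
  go : ∀ B → i < B → All (_< suc k) (diffs B (part μ)) → part μ i ∸ part μ (suc i) < suc k
  go (suc B) l (q ∷ a) with m≤n⇒m<n∨m≡n (s≤s⁻¹ l)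
  ... | inj₁ l′   = go B l′ a
  ... | inj₂ refl = q
-- From row `B` on all rows are empty, so their differences are 0.
... | no ¬l = ≤-<-trans (m∸n≤m (part μ i) (part μ (suc i)))
  (≤-<-trans (antitone-≤ (part-antitone (proj₂ p)) (≮⇒≥ ¬l)) (≤-<-trans (≤-reflexive e) z<s))

module _ (k N : ℕ) {λc : List ℕ} (pλ : IsPartition λc) (core : IsCore (suc k) λc) where

  -- The `N * suc k` empty rows provide N beads on every runner. Since `N ≤ B`, each partition of
  -- size at most N also fits into `B` rows.
  B : ℕ
  B = N * suc k + length λc

  d₀ : List ℕ
  d₀ = diffs B (part λc)

  gaps : List ℕ → List ℕ
  gaps μ = diffs B (part μ)

  private
    eλ : part λc B ≡ 0
    eλ = part-[]-length λc (m≤n+m (length λc) (N * suc k))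

    N≤B : N ≤ B
    N≤B = ≤-trans (m≤m*n N (suc k)) (m≤m+n _ (length λc))

  -- Carries the list `L` over to gap lists: having the core `λc` becomes an equality of charges,
  -- and `X`, `Y` are the two forms of the extra condition, restrictedness or the value of `hm0`.
  count-gaps : ∀ {X : List ℕ → Set} {Y : List ℕ → Set} {n L} → n ≤ N →
    (∀ {μ} → IsPartition μ → part μ B ≡ 0 → X μ → Y (gaps μ)) → (∀ {μ} → IsPartition μ → part μ B ≡ 0 → Y (gaps μ) → X μ) →
    Unique L → (∀ μ → (μ ∈ L) ⇔ (IsPartition μ × size μ ≡ n × CoreOf (suc k) μ λc × X μ)) →
    Card (λ d → charge k d ≡ charge k d₀ × gapSize d ≡ n × Y d) (length L)
  count-gaps {X} {Y} {n} {L} n≤N XY YX u char = Card-bij gaps to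
    (λ (p , e , _) (p′ , e′ , _) → diffs-injective B p p′ (part-≥size p (small e)) (part-≥size p′ (small e′)))
    surj
    (mkCard L u (λ {μ} → Equivalence.to (char μ)) (λ {μ} → Equivalence.from (char μ)) refl)
    where
    small : ∀ {s} → s ≡ n → s ≤ B
    small refl = ≤-trans n≤N N≤B
    to : ∀ {μ} → IsPartition μ × size μ ≡ n × CoreOf (suc k) μ λc × X μ → charge k (gaps μ) ≡ charge k d₀ × gapSize (gaps μ) ≡ n × Y (gaps μ)
    to (p , e , (st , _) , x) = let z = part-≥size p (small e) in
      charge-core B p z st , trans (gapSize-part B p z) e , XY p z x
    surj : ∀ {d} → charge k d ≡ charge k d₀ × gapSize d ≡ n × Y d →
      ∃ λ μ → (IsPartition μ × size μ ≡ n × CoreOf (suc k) μ λc × X μ) × gaps μ ≡ d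
    surj {d} (c , e , y) with trans (length-charge-≡ {k} d d₀ c) (length-diffs B (part λc))
    ... | len with toPartition B (partOf d) (partOf-antitone d) (partOf-≥ d (≤-reflexive len))
    ...   | μ , p , q = μ , (p , trans (sym (gapSize-part B p z)) (trans (cong gapSize g) e) ,
              (core-charge B p pλ z eλ core (trans (cong (charge k) g) c) , core) , YX p z (subst Y (sym g) y)) , g
      where
      z : part μ B ≡ 0
      z = trans (q B) (partOf-≥ d (≤-reflexive len))
      g : gaps μ ≡ d
      g = trans (diffs-cong B (λ s _ → cong₂ _∸_ (q s) (q (suc s)))) (trans (cong (λ b → diffs b (partOf d)) (sym len)) (diffs-partOf d))

  private
    flat : Flat (runners {k} d₀)
    flat = core-flat B pλ eλ core

    N≤c : VAll.All (N ≤_) (charge k d₀)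
    N≤c = subst (VAll.All (N ≤_)) (sym (charge-pad λc (N * suc k))) (rotN-suc-≥ N _)

    N≤len : N ≤ length d₀
    N≤len = ≤-trans N≤B (≤-reflexive (sym (length-diffs B (part λc))))

    size₀ : gapSize d₀ ≡ size λc
    size₀ = gapSize-part B pλ eλ

  restricted-count : ∀ {n L} → n ≤ N → Unique L →
    (∀ μ → (μ ∈ L) ⇔ (IsPartition μ × size μ ≡ n × CoreOf (suc k) μ λc × Restricted (suc k) μ)) →
    length L ≡ rhs1 (suc k) λc N 0 n
  restricted-count {n} n≤N u char = let R , r = restricted-series d₀ flat in
    trans (Card-unique
      (Card-⇔ (λ (c , e , a) → (c , a) , refl , e) (λ ((c , a) , _ , e) → c , e , a)
        (count-gaps n≤N (λ {μ} _ _ → restricted⇒All μ B) (All⇒restricted B) u char))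
      (r 0 n))
    (trans (GF-restricted d₀ flat N≤c N≤len r 0 n n≤N)
      (cong (λ s → (mono 0 s ⊛ prodTo N (λ i → pow (geom 0 (suc k * i)) k)) 0 n) size₀))

  weighted-count : ∀ {j n L} → n ≤ N → Unique L →
    (∀ μ → (μ ∈ L) ⇔ (IsPartition μ × size μ ≡ n × CoreOf (suc k) μ λc × hm0 (suc k) μ ≡ j)) →
    length L ≡ rhs2 (suc k) λc N j n
  weighted-count {j} {n} n≤N u char = let R , r = restricted-series d₀ flat in
    trans (Card-unique
      (Card-⇔ (λ (c , e , a) → c , a , e) (λ (c , a , e) → c , e , a)
        (count-gaps n≤N (λ p z x → trans (sym (hm0-quotients k B p z)) x) (λ p z y → trans (hm0-quotients k B p z) y) u char))
      (GF-divide d₀ 1 r j n))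
    (trans (GF-weighted d₀ flat N≤c N≤len (GF-divide d₀ 1 r) j n n≤N)
      (cong (λ s → (mono 0 s ⊛ prodTo N (λ i → pow (geom 0 (suc k * i)) k ⊛ geom 1 (suc k * i))) j n) size₀))

theorem6p14 : (m : ℕ) → 2 ≤ m → (λc : List ℕ) → IsPartition λc → IsCore m λc →
    (∀ (n N : ℕ) → n ≤ N → (L : List (List ℕ)) → Unique L →
    (∀ μ → (μ ∈ L) ⇔ (IsPartition μ × size μ ≡ n × CoreOf m μ λc × Restricted m μ)) →
    length L ≡ rhs1 m λc N 0 n)
    ×
    (∀ (k n N : ℕ) → n ≤ N → (L : List (List ℕ)) → Unique L →
    (∀ μ → (μ ∈ L) ⇔ (IsPartition μ × size μ ≡ n × CoreOf m μ λc × hm0 m μ ≡ k)) →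
    length L ≡ rhs2 m λc N k n)
theorem6p14 (suc k) _ λc pλ core =
  (λ n N n≤N L u char → restricted-count k N pλ core n≤N u char) ,
  (λ j n N n≤N L u char → weighted-count k N pλ core n≤N u char)
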